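{- Let $q=p^h$ with $p>3$ prime, $h\ge1$, $n\ge2$, $1\le k\le n-1$. Let $c\in C_k(n,q)$ have weight smaller than $2q^k$ with $(c,S)\neq0$ for some $(n-k)$-dimensional subspace $S$. Then every subspace of $PG(n,q)$ that meets $supp(c)$ in at least one point meets it in $1\pmod p$ points.
   Context: $C_k(n,q)$ is the $p$-ary linear code spanned over $\mathbb{F}_p$ by the rows of the incidence matrix of $k$-dimensional subspaces versus points of $PG(n,q)$ (entry $1$ iff the point lies in the subspace); codewords are vectors indexed by points. $supp(c)$ is the set of points with nonzero coordinate, the weight is $|supp(c)|$, and $(c,S)=\sum_{P\in S}c_P\in\mathbb{F}_p$. -}

module Defs where

open import Data.Nat using (ℕ; zero; suc; _+_; _*_; _∸_; _^_; _≤_; _<_)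
open import Data.Nat.Divisibility using (_∣_; _∣?_)
open import Data.Fin using (Fin)
import Data.Fin.Properties as FinP
open import Data.Vec using (Vec; []; _∷_; replicate; zipWith; map)
import Data.Vec.Properties as VecP
open import Data.List as L using (List; []; _∷_; concatMap; filter; allFin; length)
open import Data.Nat.ListAction using (sum)
open import Data.List.Relation.Unary.All using (All)
open import Data.Bool using (Bool; true; false; not; _∧_; if_then_else_)
open import Data.Product using (Σ; ∃; ∃₂; _×_; _,_; proj₁; proj₂)
open import Relation.Binary.PropositionalEquality using (_≡_; _≢_)
open import Relation.Nullary.Decidable using (does; ⌊_⌋)
open import Algebra.Structures using (IsCommutativeRing)
open import Function.Bundles using (_⇔_)

-- A finite field of order q, realised on the carrier Fin q (every finite
-- field of order q is isomorphic to such a structure).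

record FiniteField (q : ℕ) : Set where
  infixl 7 _*F_
  infixl 6 _+F_
  field
    _+F_ _*F_ : Fin q → Fin q → Fin q
    -F_     : Fin q → Fin q
    0# 1#   : Fin q
    isCommutativeRing : IsCommutativeRing _≡_ _+F_ _*F_ -F_ 0# 1#
    0≢1     : 0# ≢ 1#
    inverse : ∀ x → x ≢ 0# → ∃ λ y → x *F y ≡ 1#

module _ {q : ℕ} (F : FiniteField q) where
  open FiniteField F

  Vect : ℕ → Set
  Vect m = Vec (Fin q) m

  zeroV : ∀ {m} → Vect m
  zeroV = replicate _ 0#

  _⊕_ : ∀ {m} → Vect m → Vect m → Vect m
  u ⊕ v = zipWith _+F_ u v

  _⊙_ : ∀ {m} → Fin q → Vect m → Vect m
  a ⊙ v = map (a *F_) v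

  lincomb : ∀ {m d} → Vec (Fin q) d → Vec (Vect m) d → Vect m
  lincomb [] [] = zeroV
  lincomb (a ∷ as) (b ∷ bs) = (a ⊙ b) ⊕ lincomb as bs

  LinIndep : ∀ {m d} → Vec (Vect m) d → Set
  LinIndep {d = d} bs = ∀ (as : Vec (Fin q) d) → lincomb as bs ≡ zeroV → as ≡ replicate d 0#

  IsSubspace : ∀ {m} → (Vect m → Bool) → Set
  IsSubspace U =
    (U zeroV ≡ true)
    × (∀ u v → U u ≡ true → U v ≡ true → U (u ⊕ v) ≡ true)
    × (∀ a v → U v ≡ true → U (a ⊙ v) ≡ true)

  HasDim : ∀ {m} → (Vect m → Bool) → ℕ → Set
  HasDim {m} U d = Σ (Vec (Vect m) d) λ bs →
    LinIndep bs × (∀ v → (U v ≡ true) ⇔ (∃ λ as → lincomb as bs ≡ v))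

  -- projective subspace of PG(n,q) of projective dimension k
  -- = vector subspace of F^(n+1) of dimension k+1
  ProjSubspace : (n k : ℕ) → (Vect (suc n) → Bool) → Set
  ProjSubspace n k U = IsSubspace U × HasDim U (suc k)

  allVects : (m : ℕ) → List (Vect m)
  allVects zero = [] ∷ []
  allVects (suc m) = concatMap (λ a → L.map (a ∷_) (allVects m)) (allFin q)

  -- normalised representative of a projective point:
  -- the first nonzero coordinate equals 1
  normalised : ∀ {m} → Vect m → Bool
  normalised [] = false
  normalised (x ∷ v) = if ⌊ x FinP.≟ 0# ⌋ then normalised v else ⌊ x FinP.≟ 1# ⌋

  -- the points of PG(n,q), each listed exactly once (by its normalised representative)
  pointList : (n : ℕ) → List (Vect (suc n))
  pointList n = L.filterᵇ normalised (allVects (suc n))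

  Point : ℕ → Set
  Point n = Fin (length (pointList n))

  pt : ∀ {n} → Point n → Vect (suc n)
  pt {n} i = L.lookup (pointList n) i

  _∈ₚ_ : ∀ {n} → Point n → (Vect (suc n) → Bool) → Bool
  P ∈ₚ U = U (pt P)

  countPts : ∀ {n} → (Point n → Bool) → ℕ
  countPts {n} f = length (L.filterᵇ f (allFin (length (pointList n))))

  sumPts : ∀ {n} → (Point n → ℕ) → ℕ
  sumPts {n} f = sum (L.map f (allFin (length (pointList n))))

-- Arithmetic in F_p, with elements represented by natural numbers

_≡_[mod_] : ℕ → ℕ → ℕ → Set
a ≡ b [mod p ] = ∃₂ λ s t → a + s * p ≡ b + t * p

nonzeroₚ : ℕ → ℕ → Bool
nonzeroₚ p x = not (does (p ∣? x))

module _ {q : ℕ} (F : FiniteField q) (p : ℕ) where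

  -- a codeword: a vector over F_p indexed by the points of PG(n,q)
  -- (entries are naturals read modulo p)
  Codeword : ℕ → Set
  Codeword n = Point F n → ℕ

  incVec : ∀ {n} → (Vect F (suc n) → Bool) → Codeword n
  incVec U P = if _∈ₚ_ F P U then 1 else 0

  InCode : (n k : ℕ) → Codeword n → Set
  InCode n k c = Σ (List (ℕ × (Vect F (suc n) → Bool))) λ gens →
    All (λ g → ProjSubspace F n k (proj₂ g)) gens ×
    (∀ P → c P ≡ sum (L.map (λ g → proj₁ g * incVec (proj₂ g) P) gens) [mod p ])

  inSupp : ∀ {n} → Codeword n → Point F n → Bool
  inSupp c P = nonzeroₚ p (c P)

  weight : ∀ {n} → Codeword n → ℕ
  weight c = countPts F (inSupp c)

  -- (c,S) = Σ_{P ∈ S} c_P  (as a natural number, to be read mod p)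
  innerS : ∀ {n} → Codeword n → (Vect F (suc n) → Bool) → ℕ
  innerS c S = sumPts F (λ P → if _∈ₚ_ F P S then c P else 0)

  meetSupp : ∀ {n} → Codeword n → (Vect F (suc n) → Bool) → ℕ
  meetSupp c U = countPts F (λ P → _∈ₚ_ F P U ∧ inSupp c P)

{-# OPTIONS --safe #-}

-- A k-space meets every subspace of dimension at least n - k in 1 mod p points, so (c , T) has a
-- constant value a on these subspaces T, and B = supp c blocks them.  First, c takes the value a
-- on all of B.  Given R in B, fewness of points yields an (n - k)-space S through R meeting B in R
-- only, or in R and one further point Q.  In the second case S lies in an (n - k + 1)-space
-- with at most 2q - 3 further points of B, and Jamison's bound in a quotient plane of that space
-- tilts S to an (n - k)-space through at most one of R and Q with no other point of B; as
-- c R + c Q = a and neither summand vanishes, it passes through R, and c R = a.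
-- Hence subspaces of dimension at least n - k meet B in 1 mod p points.  Descending in dimension,
-- each subspace T has an extension with at most one new point of B, so every subspace meets B in
-- 0 or 1 mod p points; and if T is met by B and one point R is new, the line joining R to a point of
-- T ∩ B carries exactly two points of B, which is neither 0 nor 1 mod p.

module Submission where

open import Defs
open import Data.Nat as ℕ using (ℕ; zero; suc; _+_; _*_; _∸_; _^_; _≤_; _<_; z≤n; s≤s; ∣_-_∣)
import Data.Nat.Properties as ℕₚ
open import Data.Nat.Divisibility as ℕ∣ using (_∣_; _∣?_; divides)
open import Data.Nat.ListAction using (sum)
open import Data.Nat.Primality using (Prime; euclidsLemma)
open import Data.Nat.Solver using (module +-*-Solver)
open import Data.Integer as ℤ using (ℤ; -[1+_]) renaming (+_ to pos)
import Data.Integer.Properties as ℤₚ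
import Data.Sign as Sign
open import Data.Bool as Bool using (Bool; true; false; not; _∧_; if_then_else_)
import Data.Bool.Properties as BoolP
open import Data.Fin as Fin using (Fin; zero; suc)
import Data.Fin.Properties as FinP
open import Data.Fin.Permutation using (Permutation; permutation)
open import Data.List as List using (List; []; _∷_; length)
import Data.List.Properties as ListP
open import Data.List.Membership.Propositional using (_∈_)
import Data.List.Membership.Propositional.Properties as ∈P
open import Data.List.Relation.Unary.All as All using (All; []; _∷_)
import Data.List.Relation.Unary.All.Properties as AllP
open import Data.List.Relation.Unary.AllPairs using ([]; _∷_)
import Data.List.Relation.Unary.Any as Any
import Data.List.Relation.Unary.Any.Properties as AnyP
open import Data.List.Relation.Unary.Unique.Propositional using (Unique)
import Data.List.Relation.Unary.Unique.Propositional.Properties as UniqueP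
open import Data.Vec as Vec using (Vec; []; _∷_; lookup; tabulate)
import Data.Vec.Properties as VecP
open import Data.Maybe using (Maybe; just; nothing)
open import Data.Product using (Σ; ∃; ∃₂; _×_; _,_; proj₁; proj₂)
open import Data.Sum using (_⊎_; inj₁; inj₂)
open import Data.Empty using (⊥; ⊥-elim)
open import Function using (_∘_; Injective)
open import Function.Bundles using (module Equivalence)
open import Relation.Nullary using (¬_; yes; no; does)
open import Relation.Nullary.Decidable using (Dec; T?; dec-true; dec-false; ¬?; _×-dec_; decidable-stable)
open import Relation.Binary.PropositionalEquality
open import Level using (0ℓ)
open import Algebra.Bundles using (CommutativeRing)
import Algebra.Properties.AbelianGroup as AbelianGroupProperties
import Algebra.Properties.Ring as RingProperties
import Algebra.Properties.Semiring.Mult.TCOptimised as SemiringMult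
import Algebra.Properties.Semiring.Sum as SemiringSum
import Algebra.Solver.Ring as RingSolver
open import Algebra.Solver.Ring.AlmostCommutativeRing
  using (AlmostCommutativeRing; fromCommutativeRing; _-Raw-AlmostCommutative⟶_)

open +-*-Solver using ()
  renaming (solve to solveℕ; _:+_ to _⊹_; _:*_ to _⊛_; _:=_ to _⊜_; con to conℕ)

-- Finite fields and Jamison's bound

-- All subspaces are found by one averaging argument. If T has vector codimension s, the points of B
-- outside T are spread over the (q^s - 1)/(q - 1) spaces one dimension above T, so one of these
-- gains fewer than j points as soon as |B - T| < j(q^s - 1)/(q - 1). Against |B| < 2q^k this allows
-- j = 1 at s = k + 2, j = 2 at s = k + 1 and, when two points of B already lie in T, j = 2(q - 1)
-- at s = k. The last value is exactly the number of affine forms below which Jamison's bound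
-- applies; this is where the weight bound 2q^k meets the polynomial method. The plane of that bound
-- is a plane of parameters: its points (α, β) are the hyperplanes of the larger space that contain
-- T₁ and avoid w, with S at the origin. Each new point of B forbids at most a line of parameters,
-- never through the origin, while R and Q lie on the tilted space only for α = 0 and β = 0
-- respectively. In the descent, losing a point at every step would produce the residues -1, -2 and
-- so on.

module FieldArithmetic {q : ℕ} (F : FiniteField q) where

  open FiniteField F public

  commutativeRing : CommutativeRing 0ℓ 0ℓ
  commutativeRing = record { isCommutativeRing = isCommutativeRing }

  open CommutativeRing commutativeRing public
    using (ring; semiring; +-abelianGroup; +-assoc; +-comm; +-identityˡ; +-identityʳ;
           -‿inverseˡ; -‿inverseʳ; *-assoc; *-comm; *-identityˡ; *-identityʳ; zeroˡ; zeroʳ)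
  open RingProperties ring public using (-‿involutive; -‿distribˡ-*; -‿distribʳ-*; -0#≈0#)
  open AbelianGroupProperties +-abelianGroup public using () renaming (⁻¹-∙-comm to -‿+-comm)

  module IntegerCoefficients where
    open SemiringMult semiring using (×-homo-+; ×1-homo-*; 1+×) renaming (_×_ to _·_)

    -- The operations of `F` are abstract and do not compute, so the ring solver normalises over the
    -- integers, carried to the field by the canonical ring homomorphism.
    ι : ℤ → Fin q
    ι (pos n)    = n · 1#
    ι -[1+ n ] = -F (suc n · 1#)

    ι-⊖ : ∀ m n → ι (m ℤ.⊖ n) ≡ (m · 1#) +F (-F (n · 1#))
    ι-⊖ m zero = sym (trans (cong ((m · 1#) +F_) -0#≈0#) (+-identityʳ _))
    ι-⊖ zero (suc n) = sym (+-identityˡ _)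
    ι-⊖ (suc m) (suc n) = begin
      ι (suc m ℤ.⊖ suc n)                        ≡⟨ cong ι (ℤₚ.[1+m]⊖[1+n]≡m⊖n m n) ⟩
      ι (m ℤ.⊖ n)                                ≡⟨ ι-⊖ m n ⟩
      M +F (-F N)                                ≡⟨ cong (M +F_) (+-identityˡ _) ⟨
      M +F (0# +F (-F N))                        ≡⟨ cong (λ x → M +F (x +F (-F N))) (-‿inverseʳ 1#) ⟨
      M +F ((1# +F (-F 1#)) +F (-F N))           ≡⟨ cong (M +F_) (+-assoc _ _ _) ⟩
      M +F (1# +F ((-F 1#) +F (-F N)))           ≡⟨ +-assoc _ _ _ ⟨
      (M +F 1#) +F ((-F 1#) +F (-F N))           ≡⟨ cong₂ _+F_ (+-comm _ _) (-‿+-comm 1# N) ⟩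
      (1# +F M) +F (-F (1# +F N))                ≡⟨ cong₂ (λ x y → x +F (-F y)) (1+× m 1#) (1+× n 1#) ⟨
      (suc m · 1#) +F (-F (suc n · 1#))          ∎
      where
      open ≡-Reasoning
      M = m · 1#
      N = n · 1#

    ι-neg : ∀ i → ι (ℤ.- i) ≡ -F (ι i)
    ι-neg (pos zero)  = sym -0#≈0#
    ι-neg (pos (suc n)) = refl
    ι-neg -[1+ n ]  = sym (-‿involutive _)

    ι-+ : ∀ i j → ι (i ℤ.+ j) ≡ ι i +F ι j
    ι-+ (pos m) (pos n) = ×-homo-+ 1# m n
    ι-+ (pos m) -[1+ n ] = ι-⊖ m (suc n)
    ι-+ -[1+ m ] (pos n) = trans (ι-⊖ n (suc m)) (+-comm _ _)
    ι-+ -[1+ m ] -[1+ n ] = begin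
      -F (suc (suc (m + n)) · 1#)                     ≡⟨ cong (λ k → -F (k · 1#)) (cong suc (ℕₚ.+-suc m n)) ⟨
      -F ((suc m + suc n) · 1#)                       ≡⟨ cong -F_ (×-homo-+ 1# (suc m) (suc n)) ⟩
      -F ((suc m · 1#) +F (suc n · 1#))               ≡⟨ -‿+-comm _ _ ⟨
      (-F (suc m · 1#)) +F (-F (suc n · 1#))          ∎
      where open ≡-Reasoning

    ι-neg-◃ : ∀ n → ι (Sign.- ℤ.◃ n) ≡ -F (n · 1#)
    ι-neg-◃ zero    = sym -0#≈0#
    ι-neg-◃ (suc n) = refl

    ι-pos-◃ : ∀ n → ι (Sign.+ ℤ.◃ n) ≡ n · 1#
    ι-pos-◃ zero    = refl
    ι-pos-◃ (suc n) = refl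

    ι-* : ∀ i j → ι (i ℤ.* j) ≡ ι i *F ι j
    ι-* (pos m) (pos n) = trans (ι-pos-◃ (m * n)) (×1-homo-* m n)
    ι-* (pos m) -[1+ n ] = trans (ι-neg-◃ (m * suc n))
      (trans (cong -F_ (×1-homo-* m (suc n))) (-‿distribʳ-* _ _))
    ι-* -[1+ m ] (pos n) = trans (ι-neg-◃ (suc m * n))
      (trans (cong -F_ (×1-homo-* (suc m) n)) (-‿distribˡ-* _ _))
    ι-* -[1+ m ] -[1+ n ] = begin
      (suc m * suc n) · 1#                            ≡⟨ ×1-homo-* (suc m) (suc n) ⟩
      (suc m · 1#) *F (suc n · 1#)                    ≡⟨ -‿involutive _ ⟨
      -F (-F ((suc m · 1#) *F (suc n · 1#)))          ≡⟨ cong -F_ (-‿distribʳ-* _ _) ⟩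
      -F ((suc m · 1#) *F (-F (suc n · 1#)))          ≡⟨ -‿distribˡ-* _ _ ⟩
      (-F (suc m · 1#)) *F (-F (suc n · 1#))          ∎
      where open ≡-Reasoning

    target : AlmostCommutativeRing 0ℓ 0ℓ
    target = fromCommutativeRing commutativeRing

    morphism : ℤ.+-*-rawRing -Raw-AlmostCommutative⟶ target
    morphism = record
      { ⟦_⟧ = ι ; +-homo = ι-+ ; *-homo = ι-* ; -‿homo = ι-neg ; 0-homo = refl ; 1-homo = refl }

    _≟ι_ : ∀ i j → Maybe (ι i ≡ ι j)
    i ≟ι j with i ℤ.≟ j
    ... | yes eq = just (cong ι eq)
    ... | no _   = nothing

    open RingSolver ℤ.+-*-rawRing target morphism _≟ι_ public
      using (solve; _:=_; _:+_; _:*_; :-_; con)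

  open IntegerCoefficients public using (solve; _:=_; _:+_; _:*_; :-_; con)

  +F-cancel-neg : ∀ {x y} → x +F (-F y) ≡ 0# → x ≡ y
  +F-cancel-neg {x} {y} eq = trans
    (solve 2 (λ x y → x := (x :+ (:- y)) :+ y) refl x y) (trans (cong (_+F y) eq) (+-identityˡ y))

  *F-zero : ∀ {x y} → x *F y ≡ 0# → x ≢ 0# → y ≡ 0#
  *F-zero {x} {y} xy≡0 x≢0 with inverse x x≢0
  ... | x⁻¹ , xx⁻¹≡1 = begin
    y                   ≡⟨ *-identityˡ y ⟨
    1# *F y             ≡⟨ cong (_*F y) xx⁻¹≡1 ⟨
    (x *F x⁻¹) *F y     ≡⟨ solve 3 (λ x z y → (x :* z) :* y := z :* (x :* y)) refl x x⁻¹ y ⟩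
    x⁻¹ *F (x *F y)     ≡⟨ cong (x⁻¹ *F_) xy≡0 ⟩
    x⁻¹ *F 0#           ≡⟨ zeroʳ _ ⟩
    0#                  ∎
    where open ≡-Reasoning

  *F-nonzero : ∀ {x y} → x ≢ 0# → y ≢ 0# → x *F y ≢ 0#
  *F-nonzero x≢0 y≢0 xy≡0 = y≢0 (*F-zero xy≡0 x≢0)

  -- Polynomials over the field and their roots

  infixr 8 _^F_
  _^F_ : Fin q → ℕ → Fin q
  x ^F zero  = 1#
  x ^F suc i = x *F x ^F i

  *F-^F : ∀ x y i → (x *F y) ^F i ≡ x ^F i *F y ^F i
  *F-^F x y zero = sym (*-identityˡ 1#)
  *F-^F x y (suc i) = trans (cong ((x *F y) *F_) (*F-^F x y i))
    (solve 4 (λ x y a b → (x :* y) :* (a :* b) := (x :* a) :* (y :* b)) refl x y _ _)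

  -- The leading coefficient 1 is not stored: the degree is the length of the list, and every
  -- polynomial is nonzero by construction.
  evalMonic : List (Fin q) → Fin q → Fin q
  evalMonic []       x = 1#
  evalMonic (a ∷ as) x = a +F x *F evalMonic as x

  -- Horner's scheme: the quotient by x - r stays monic, so `root-bound` can go by induction on the
  -- degree.
  divideMonic : ∀ r a as → ∃ λ bs → length bs ≡ length as ×
    (∀ x → evalMonic (a ∷ as) x ≡ evalMonic (a ∷ as) r +F (x +F (-F r)) *F evalMonic bs x)
  divideMonic r a [] = [] , refl , λ x →
    solve 3 (λ a x r → a :+ x :* con (pos 1) := (a :+ r :* con (pos 1)) :+ (x :+ (:- r)) :* con (pos 1))
      refl a x r
  divideMonic r a (a′ ∷ as) with divideMonic r a′ as
  ... | bs , len , division = evalMonic (a′ ∷ as) r ∷ bs , cong suc len , λ x →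
    trans (cong (λ y → a +F x *F y) (division x))
      (solve 5 (λ a x r e b → a :+ x :* (e :+ (x :+ (:- r)) :* b)
                           := (a :+ r :* e) :+ (x :+ (:- r)) :* (e :+ x :* b))
         refl a x r _ _)

  root-bound : ∀ {k} as (root : Fin k → Fin q) → Injective _≡_ _≡_ root →
    (∀ i → evalMonic as (root i) ≡ 0#) → k ≤ length as
  root-bound {zero} as root inj isRoot = z≤n
  root-bound {suc k} [] root inj isRoot = ⊥-elim (0≢1 (sym (isRoot zero)))
  root-bound {suc k} (a ∷ as) root inj isRoot with divideMonic (root zero) a as
  ... | bs , len , division = s≤s (subst (k ≤_) len
    (root-bound bs (root ∘ suc) (FinP.suc-injective ∘ inj) λ i →
      *F-zero
        (vanish (isRoot zero) (division (root (suc i))) (isRoot (suc i)))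
        λ eq → FinP.0≢1+n (sym (inj (+F-cancel-neg eq)))))
    where
    vanish : ∀ {e r s} → r ≡ 0# → e ≡ r +F s → e ≡ 0# → s ≡ 0#
    vanish refl e≡s e≡0 = trans (sym (+-identityˡ _)) (trans (sym e≡s) e≡0)

  module FSum = SemiringSum semiring
  ∑F : ∀ {n} → (Fin n → Fin q) → Fin q
  ∑F = FSum.sum

  ∑F-cong : ∀ {n} {f g : Fin n → Fin q} → (∀ i → f i ≡ g i) → ∑F f ≡ ∑F g
  ∑F-cong = FSum.sum-cong-≗

  ∑F-zero : ∀ {n} {f : Fin n → Fin q} → (∀ i → f i ≡ 0#) → ∑F f ≡ 0#
  ∑F-zero {n} eq = trans (∑F-cong eq) (FSum.sum-replicate-zero n)

  ∑F-single : ∀ {n} (f : Fin n → Fin q) j → (∀ i → i ≢ j → f i ≡ 0#) → ∑F f ≡ f j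
  ∑F-single f zero vanish =
    trans (cong (f zero +F_) (∑F-zero (λ i → vanish (suc i) λ ()))) (+-identityʳ _)
  ∑F-single f (suc j) vanish =
    trans (cong₂ _+F_ (vanish zero λ ()) (∑F-single (f ∘ suc) j λ i i≢j → vanish (suc i) (i≢j ∘ FinP.suc-injective)))
      (+-identityˡ _)

  -- Power sums over the field

  translation : Fin q → Permutation q q
  translation a = permutation (_+F a) (_+F (-F a))
    (λ x → solve 2 (λ x a → (x :+ (:- a)) :+ a := x) refl x a)
    (λ x → solve 2 (λ x a → (x :+ a) :+ (:- a) := x) refl x a)

  scaling : ∀ a → a ≢ 0# → Permutation q q
  scaling a a≢0 = permutation (a *F_) (b *F_) (cancel a b ab≡1) (cancel b a (trans (*-comm b a) ab≡1))
    where
    b = proj₁ (inverse a a≢0)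
    ab≡1 = proj₂ (inverse a a≢0)
    cancel : ∀ a b → a *F b ≡ 1# → ∀ x → a *F (b *F x) ≡ x
    cancel a b ab≡1 x = trans (sym (*-assoc a b x)) (trans (cong (_*F x) ab≡1) (*-identityˡ x))

  powerSum : ℕ → Fin q
  powerSum i = ∑F (_^F i)

  -- Translation by 1 permutes the field, so X = X + N for the sum X of all elements, with N the sum
  -- of q ones.
  powerSum-zero : powerSum 0 ≡ 0#
  powerSum-zero = begin
    N                          ≡⟨ solve 2 (λ N X → N := (:- X) :+ (X :+ N)) refl N X ⟩
    (-F X) +F (X +F N)         ≡⟨ cong ((-F X) +F_) (FSum.∑-distrib-+ (λ x → x) (λ _ → 1#)) ⟨
    (-F X) +F ∑F (_+F 1#)      ≡⟨ cong ((-F X) +F_) (FSum.sum-permute (λ x → x) (translation 1#)) ⟨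
    (-F X) +F X                ≡⟨ -‿inverseˡ X ⟩
    0#                         ∎
    where
    open ≡-Reasoning
    N X : Fin q
    N = powerSum 0
    X = ∑F (λ x → x)

  -- Otherwise all q - 1 nonzero elements would be roots of y^(i+1) - 1, more than its degree.
  power≢1 : ∀ i → suc (suc i) < q → ∃ λ y → y ≢ 0# × y ^F suc i ≢ 1#
  power≢1 i bound with FinP.any? (λ y → ¬? (y FinP.≟ 0#) ×-dec ¬? (y ^F suc i FinP.≟ 1#))
  ... | yes found = found
  ... | no none = ⊥-elim (contra q F-nonzeros bound)
    where
    coeffs : ℕ → List (Fin q)
    coeffs zero    = []
    coeffs (suc j) = 0# ∷ coeffs j
    eval-coeffs : ∀ j x → evalMonic (coeffs j) x ≡ x ^F j
    eval-coeffs zero x = refl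
    eval-coeffs (suc j) x = trans (+-identityˡ _) (cong (x *F_) (eval-coeffs j x))
    length-coeffs : ∀ j → length (coeffs j) ≡ j
    length-coeffs zero = refl
    length-coeffs (suc j) = cong suc (length-coeffs j)
    unity : ∀ y → y ≢ 0# → evalMonic ((-F 1#) ∷ coeffs i) y ≡ 0#
    unity y y≢0 = trans (cong (λ z → (-F 1#) +F y *F z) (eval-coeffs i y))
      (trans (cong ((-F 1#) +F_)
        (decidable-stable (y *F y ^F i FinP.≟ 1#) λ ne → none (y , y≢0 , ne))) (-‿inverseˡ 1#))
    -- `punchIn` around `0#` lists the nonzero elements; it needs `q` in the form `suc r`, hence the
    -- detour through an equation.
    F-nonzeros : ∀ r → q ≡ suc r → Σ (Fin r → Fin q) λ f → Injective _≡_ _≡_ f × (∀ i → f i ≢ 0#)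
    F-nonzeros r refl = Fin.punchIn 0# , (λ {x} {y} → FinP.punchIn-injective 0# x y) , λ i → FinP.punchInᵢ≢i 0# i
    contra : ∀ q′ → (∀ r → q′ ≡ suc r → Σ (Fin r → Fin q) λ f → Injective _≡_ _≡_ f × (∀ i → f i ≢ 0#)) →
      ¬ (suc (suc i) < q′)
    contra (suc r) nonzeros (s≤s lt) with nonzeros r refl
    ... | f , inj , f≢0 = ℕₚ.<⇒≱ lt (subst (r ≤_) (cong suc (length-coeffs i))
      (root-bound ((-F 1#) ∷ coeffs i) f inj λ j → unity (f j) (f≢0 j)))

  -- For a positive exponent e, scaling by y permutes the field and gives y^e S = S for the power
  -- sum S; a nonzero y with y^e different from 1 forces S = 0.
  powerSum-vanishes : ∀ i → suc i < q → powerSum i ≡ 0#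
  powerSum-vanishes zero _ = powerSum-zero
  powerSum-vanishes (suc i) bound with power≢1 i bound
  ... | y , y≢0 , yⁱ≢1 = *F-zero
    (trans (solve 2 (λ a s → (a :+ (:- con (pos 1))) :* s := a :* s :+ (:- s)) refl (y ^F suc i) S)
      (trans (cong (_+F (-F S)) scaled) (-‿inverseʳ S)))
    (yⁱ≢1 ∘ +F-cancel-neg)
    where
    S = powerSum (suc i)
    scaled : y ^F suc i *F S ≡ S
    scaled = trans (FSum.*-distribˡ-sum (y ^F suc i) (_^F suc i))
      (trans (∑F-cong λ x → sym (*F-^F y x (suc i)))
        (sym (FSum.sum-permute (_^F suc i) (scaling y y≢0))))

  -- The triple (x , y , z) stands for the affine form z + αx + βy in the unknowns α and β.
  formValue : Fin q → Fin q → Fin q × Fin q × Fin q → Fin q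
  formValue α β (x , y , z) = z +F (α *F x +F β *F y)

  formProduct : List (Fin q × Fin q × Fin q) → Fin q → Fin q → Fin q
  formProduct []       α β = 1#
  formProduct (l ∷ ls) α β = formValue α β l *F formProduct ls α β

  -- The monomial factor is carried along so that multiplying out one form leads to moments with one
  -- form fewer, as in `moment-cons`.
  moment : ℕ → ℕ → List (Fin q × Fin q × Fin q) → Fin q
  moment i j ls = ∑F λ α → ∑F λ β → α ^F i *F (β ^F j *F formProduct ls α β)

  moment-cons : ∀ i j x y z ls → moment i j ((x , y , z) ∷ ls) ≡
    z *F moment i j ls +F (x *F moment (suc i) j ls +F y *F moment i (suc j) ls)
  moment-cons i j x y z ls = begin
    ∑∑ (λ α β → α ^F i *F (β ^F j *F (formValue α β (x , y , z) *F P α β)))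
      ≡⟨ (∑F-cong λ α → ∑F-cong λ β → expand α β (α ^F i) (β ^F j) (P α β)) ⟩
    ∑∑ (λ α β → z *F A α β +F (x *F B α β +F y *F C α β))
      ≡⟨ ∑∑-+ (λ α β → z *F A α β) (λ α β → x *F B α β +F y *F C α β) ⟩
    ∑∑ (λ α β → z *F A α β) +F ∑∑ (λ α β → x *F B α β +F y *F C α β)
      ≡⟨ cong₂ _+F_ (∑∑-* z A) (trans (∑∑-+ (λ α β → x *F B α β) (λ α β → y *F C α β)) (cong₂ _+F_ (∑∑-* x B) (∑∑-* y C))) ⟩
    z *F ∑∑ A +F (x *F ∑∑ B +F y *F ∑∑ C) ∎
    where
    open ≡-Reasoning
    ∑∑ : (Fin q → Fin q → Fin q) → Fin q
    ∑∑ f = ∑F λ α → ∑F λ β → f α β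
    ∑∑-+ : ∀ f g → ∑∑ (λ α β → f α β +F g α β) ≡ ∑∑ f +F ∑∑ g
    ∑∑-+ f g = trans (∑F-cong λ α → FSum.∑-distrib-+ (f α) (g α)) (FSum.∑-distrib-+ (∑F ∘ f) (∑F ∘ g))
    ∑∑-* : ∀ a f → ∑∑ (λ α β → a *F f α β) ≡ a *F ∑∑ f
    ∑∑-* a f = sym (trans (FSum.*-distribˡ-sum a (∑F ∘ f)) (∑F-cong λ α → FSum.*-distribˡ-sum a (f α)))
    P A B C : Fin q → Fin q → Fin q
    P = formProduct ls
    A α β = α ^F i *F (β ^F j *F P α β)
    B α β = α ^F suc i *F (β ^F j *F P α β)
    C α β = α ^F i *F (β ^F suc j *F P α β)
    expand : ∀ α β a b p → a *F (b *F (formValue α β (x , y , z) *F p)) ≡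
      z *F (a *F (b *F p)) +F (x *F ((α *F a) *F (b *F p)) +F y *F (a *F ((β *F b) *F p)))
    expand α β a b p = solve 8 (λ α β a b p x y z →
      a :* (b :* ((z :+ (α :* x :+ β :* y)) :* p)) :=
      z :* (a :* (b :* p)) :+ (x :* ((α :* a) :* (b :* p)) :+ y :* (a :* ((β :* b) :* p))))
      refl α β a b p x y z

  -- The quantity i + j + `length ls` bounds the total degree and does not grow when a form is
  -- multiplied out. With no forms left the sum is a product of two power sums, and i + j < 2(q - 1)
  -- puts one exponent below q - 1.
  moment-vanishes : ∀ i j ls → suc (suc (i + j + length ls)) < q + q → moment i j ls ≡ 0#
  moment-vanishes i j [] bound = begin
    moment i j []                                   ≡⟨ (∑F-cong λ α →
             trans (∑F-cong λ β → cong (α ^F i *F_) (*-identityʳ (β ^F j)))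
                   (sym (FSum.*-distribˡ-sum (α ^F i) (_^F j)))) ⟩
    ∑F (λ α → α ^F i *F powerSum j)                 ≡⟨ FSum.*-distribʳ-sum (powerSum j) (_^F i) ⟨
    powerSum i *F powerSum j                        ≡⟨ split (suc i ℕ.<? q) ⟩
    0#                                              ∎
    where
    open ≡-Reasoning
    split : _ → powerSum i *F powerSum j ≡ 0#
    split (yes i<) = trans (cong (_*F powerSum j) (powerSum-vanishes i i<)) (zeroˡ _)
    split (no i≮) = trans (cong (powerSum i *F_) (powerSum-vanishes j j<)) (zeroʳ _)
      where
      j< : suc j < q
      j< = ℕₚ.+-cancelˡ-< q (suc j) q (ℕₚ.≤-<-trans (ℕₚ.+-monoˡ-≤ (suc j) (ℕₚ.≮⇒≥ i≮))
        (subst (_< q + q) (trans (cong (λ k → suc (suc k)) (ℕₚ.+-identityʳ (i + j))) (cong suc (sym (ℕₚ.+-suc i j)))) bound))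
  moment-vanishes i j ((x , y , z) ∷ ls) bound = begin
    moment i j ((x , y , z) ∷ ls)                   ≡⟨ moment-cons i j x y z ls ⟩
    z *F moment i j ls +F (x *F moment (suc i) j ls +F y *F moment i (suc j) ls)
      ≡⟨ cong₂ _+F_ (cong (z *F_) (moment-vanishes i j ls (ℕₚ.<-trans (ℕₚ.n<1+n _) bound′)))
           (cong₂ _+F_ (cong (x *F_) (moment-vanishes (suc i) j ls bound′))
             (cong (y *F_) (moment-vanishes i (suc j) ls
               (subst (λ k → suc (suc (k + length ls)) < q + q) (sym (ℕₚ.+-suc i j)) bound′)))) ⟩
    z *F 0# +F (x *F 0# +F y *F 0#)                 ≡⟨ solve 3 (λ x y z → z :* con (pos 0) :+ (x :* con (pos 0) :+ y :* con (pos 0)) := con (pos 0)) refl x y z ⟩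
    0#                                              ∎
    where
    open ≡-Reasoning
    bound′ : suc (suc (suc (i + j) + length ls)) < q + q
    bound′ = subst (λ k → suc (suc k) < q + q) (ℕₚ.+-suc (i + j) (length ls)) bound

  formProduct-nonzero : ∀ {α β} ls → All (λ l → formValue α β l ≢ 0#) ls → formProduct ls α β ≢ 0#
  formProduct-nonzero []       []         = 0≢1 ∘ sym
  formProduct-nonzero (l ∷ ls) (nz ∷ nzs) = *F-nonzero nz (formProduct-nonzero ls nzs)

  formProduct-nonzero⁻ : ∀ {α β} ls → formProduct ls α β ≢ 0# → All (λ l → formValue α β l ≢ 0#) ls
  formProduct-nonzero⁻ []       nz = []
  formProduct-nonzero⁻ {α} {β} (l ∷ ls) nz =
    (λ eq → nz (trans (cong (_*F formProduct ls α β) eq) (zeroˡ _))) ∷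
    formProduct-nonzero⁻ ls (λ eq → nz (trans (cong (formValue α β l *F_) eq) (zeroʳ _)))

  -- The polynomial method of Jamison and Brouwer–Schrijver: a product of fewer than 2(q - 1)
  -- affine forms sums to 0 over the plane, so it cannot be nonzero at the origin only.
  jamison : ∀ ls → suc (suc (length ls)) < q + q → All (λ l → formValue 0# 0# l ≢ 0#) ls →
    ∃₂ λ α β → ¬ (α ≡ 0# × β ≡ 0#) × All (λ l → formValue α β l ≢ 0#) ls
  jamison ls bound origin with FinP.any? (λ α → FinP.any? λ β →
      ¬? (α FinP.≟ 0# ×-dec β FinP.≟ 0#) ×-dec ¬? (formProduct ls α β FinP.≟ 0#))
  ... | yes (α , β , ne , nz) = α , β , ne , formProduct-nonzero⁻ ls nz
  ... | no none = ⊥-elim (formProduct-nonzero ls origin (trans (sym atOrigin) (moment-vanishes 0 0 ls bound)))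
    where
    vanish : ∀ α β → ¬ (α ≡ 0# × β ≡ 0#) → 1# *F (1# *F formProduct ls α β) ≡ 0#
    vanish α β ne = trans (cong (λ x → 1# *F (1# *F x))
      (decidable-stable (_ FinP.≟ 0#) λ nz → none (α , β , ne , nz)))
      (trans (cong (1# *F_) (zeroʳ 1#)) (zeroʳ 1#))
    -- If the product vanishes at all other parameters, the double sum reduces to its nonzero value
    -- at the origin, although its degree makes it 0.
    atOrigin : moment 0 0 ls ≡ formProduct ls 0# 0#
    atOrigin = trans
      (∑F-single _ 0# λ α α≢0 → ∑F-zero λ β → vanish α β (α≢0 ∘ proj₁))
      (trans (∑F-single _ 0# λ β β≢0 → vanish 0# β (β≢0 ∘ proj₂))
        (trans (*-identityˡ _) (*-identityˡ _)))

-- Counting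

module NSum = SemiringSum ℕₚ.+-*-semiring

∑ : ∀ {n} → (Fin n → ℕ) → ℕ
∑ = NSum.sum

∑-cong : ∀ {n} {f g : Fin n → ℕ} → (∀ i → f i ≡ g i) → ∑ f ≡ ∑ g
∑-cong = NSum.sum-cong-≗

∑-zero : ∀ {n} {f : Fin n → ℕ} → (∀ i → f i ≡ 0) → ∑ f ≡ 0
∑-zero {n} eq = trans (∑-cong eq) (NSum.sum-replicate-zero n)

∑-mono : ∀ {n} {f g : Fin n → ℕ} → (∀ i → f i ≤ g i) → ∑ f ≤ ∑ g
∑-mono {zero}  f≤g = z≤n
∑-mono {suc n} f≤g = ℕₚ.+-mono-≤ (f≤g zero) (∑-mono (f≤g ∘ suc))

∑-const : ∀ n c → ∑ {n} (λ _ → c) ≡ n * c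
∑-const zero    c = refl
∑-const (suc n) c = cong (c +_) (∑-const n c)

∑-single : ∀ {n} (f : Fin n → ℕ) j → (∀ i → i ≢ j → f i ≡ 0) → ∑ f ≡ f j
∑-single f zero vanish =
  trans (cong (f zero +_) (∑-zero (λ i → vanish (suc i) λ ()))) (ℕₚ.+-identityʳ _)
∑-single f (suc j) vanish = cong₂ _+_ (vanish zero λ ())
  (∑-single (f ∘ suc) j λ i i≢j → vanish (suc i) (i≢j ∘ FinP.suc-injective))

ind : Bool → ℕ
ind b = if b then 1 else 0

ind-∧ : ∀ a b → ind (a ∧ b) ≡ ind a * ind b
ind-∧ true  b = sym (ℕₚ.+-identityʳ (ind b))
ind-∧ false b = refl

ind-not : ∀ b → ind (not b) + ind b ≡ 1
ind-not true  = refl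
ind-not false = refl

ind-mono : ∀ {a b} → (a ≡ true → b ≡ true) → ind a ≤ ind b
ind-mono {true}  a⇒b rewrite a⇒b refl = ℕₚ.≤-refl
ind-mono {false} a⇒b = z≤n

bool-ext : ∀ {a b} → (a ≡ true → b ≡ true) → (b ≡ true → a ≡ true) → a ≡ b
bool-ext {true}  {b}     f g = sym (f refl)
bool-ext {false} {true}  f g = g refl
bool-ext {false} {false} f g = refl

≡true≢false : ∀ {b} → b ≡ true → b ≢ false
≡true≢false refl ()

≢true⇒≡false : ∀ {b} → b ≢ true → b ≡ false
≢true⇒≡false {true}  ne = ⊥-elim (ne refl)
≢true⇒≡false {false} ne = refl

∧-intro : ∀ {a b} → a ≡ true → b ≡ true → a ∧ b ≡ true
∧-intro refl refl = refl

∧-elim : ∀ {a b} → a ∧ b ≡ true → a ≡ true × b ≡ true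
∧-elim {true} {true} refl = refl , refl

not-intro : ∀ {b} → b ≡ false → not b ≡ true
not-intro refl = refl

not-elim : ∀ {b} → not b ≡ true → b ≡ false
not-elim {false} refl = refl

count : ∀ {n} → (Fin n → Bool) → ℕ
count f = ∑ (ind ∘ f)

length-filterᵇ : ∀ {a} {A : Set a} {n} (f : A → Bool) (g : Fin n → A) →
  length (List.filterᵇ f (List.tabulate g)) ≡ count (f ∘ g)
length-filterᵇ {n = zero} f g = refl
length-filterᵇ {n = suc n} f g with f (g zero)
... | true  = cong suc (length-filterᵇ f (g ∘ suc))
... | false = length-filterᵇ f (g ∘ suc)

sum-map-tabulate : ∀ {a} {A : Set a} {n} (f : A → ℕ) (g : Fin n → A) →
  sum (List.map f (List.tabulate g)) ≡ ∑ (f ∘ g)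
sum-map-tabulate {n = zero}  f g = refl
sum-map-tabulate {n = suc n} f g = cong (f (g zero) +_) (sum-map-tabulate f (g ∘ suc))

count-none : ∀ {n} {f : Fin n → Bool} → (∀ i → f i ≡ false) → count f ≡ 0
count-none none = ∑-zero λ i → cong ind (none i)

count-none⁻ : ∀ {n} {f : Fin n → Bool} → count f ≡ 0 → ∀ i → f i ≡ false
count-none⁻ {f = f} eq zero with f zero
... | false = refl
count-none⁻ {f = f} eq (suc i) = count-none⁻ (ℕₚ.m+n≡0⇒n≡0 (ind (f zero)) eq) i

count-one : ∀ {n} {f : Fin n → Bool} j → f j ≡ true → (∀ i → f i ≡ true → i ≡ j) → count f ≡ 1
count-one j fj unique = trans
  (∑-single _ j λ i i≢j → cong ind (≢true⇒≡false (i≢j ∘ unique i))) (cong ind fj)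

count<2 : ∀ {n} (f : Fin n → Bool) → count f < 2 →
  (∀ i → f i ≡ false) ⊎ ∃ λ j → f j ≡ true × (∀ i → f i ≡ true → i ≡ j)
count<2 {zero} f lt = inj₁ λ ()
count<2 {suc n} f lt with f zero in f0
count<2 {suc n} f (s≤s lt) | true = inj₂ (zero , f0 ,
  λ { zero _ → refl
    ; (suc i) fi → ⊥-elim (≡true≢false fi (count-none⁻ (ℕₚ.n<1⇒n≡0 lt) i)) })
count<2 {suc n} f lt | false with count<2 (f ∘ suc) lt
... | inj₁ none = inj₁ λ { zero → f0 ; (suc i) → none i }
... | inj₂ (j , fj , unique) = inj₂ (suc j , fj ,
  λ { zero fi → ⊥-elim (≡true≢false fi f0) ; (suc i) fi → cong suc (unique i fi) })

count≤1 : ∀ {n} (f : Fin n → Bool) → (∀ i j → f i ≡ true → f j ≡ true → i ≡ j) → count f ≤ 1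
count≤1 {zero} f unique = z≤n
count≤1 {suc n} f unique with f zero in f0
... | true = s≤s (ℕₚ.≤-reflexive (count-none λ i → ≢true⇒≡false λ fi → FinP.0≢1+n (unique zero (suc i) f0 fi)))
... | false = count≤1 (f ∘ suc) λ i j fi fj → FinP.suc-injective (unique (suc i) (suc j) fi fj)

count-positive : ∀ {n} {f : Fin n → Bool} → 1 ≤ count f → ∃ λ i → f i ≡ true
count-positive {zero} ()
count-positive {suc n} {f} positive with f zero in f0
... | true  = zero , f0
... | false with count-positive positive
...   | i , fi = suc i , fi

count-+ : ∀ {n} {f g h : Fin n → Bool} → (∀ i → ind (f i) ≡ ind (g i) + ind (h i)) →
  count f ≡ count g + count h
count-+ {g = g} {h} eq = trans (∑-cong eq) (NSum.∑-distrib-+ (ind ∘ g) (ind ∘ h))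

private variable q m : ℕ

-- Summation over all vectors goes through the enumeration of Vec (Fin q) m by Fin (q ^ m).
decode : Fin (q ^ m) → Vec (Fin q) m
decode i = tabulate (Fin.finToFun i)

encode : Vec (Fin q) m → Fin (q ^ m)
encode v = Fin.funToFin (lookup v)

decode-encode : (v : Vec (Fin q) m) → decode (encode v) ≡ v
decode-encode v = trans (VecP.tabulate-cong (FinP.finToFun-funToFin (lookup v))) (VecP.tabulate∘lookup v)

encode-decode : ∀ q m (i : Fin (q ^ m)) → encode {q} {m} (decode i) ≡ i
encode-decode q m i = trans (funToFin-cong {m} (VecP.lookup∘tabulate (Fin.finToFun i))) (FinP.funToFin-finToFin {m} {q} i)
  where
  funToFin-cong : ∀ {n} {f g : Fin n → Fin q} → (∀ i → f i ≡ g i) → Fin.funToFin f ≡ Fin.funToFin g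
  funToFin-cong {zero} eq = refl
  funToFin-cong {suc n} eq = cong₂ Fin.combine (eq zero) (funToFin-cong (eq ∘ suc))

∑V : (Vec (Fin q) m → ℕ) → ℕ
∑V {q} {m} f = ∑ {q ^ m} (f ∘ decode)

∑V-cong : {f g : Vec (Fin q) m → ℕ} → (∀ v → f v ≡ g v) → ∑V f ≡ ∑V g
∑V-cong eq = ∑-cong (eq ∘ decode)

∑V-mono : {f g : Vec (Fin q) m → ℕ} → (∀ v → f v ≤ g v) → ∑V f ≤ ∑V g
∑V-mono le = ∑-mono (le ∘ decode)

∑V-+ : (f g : Vec (Fin q) m → ℕ) → ∑V (λ v → f v + g v) ≡ ∑V f + ∑V g
∑V-+ f g = NSum.∑-distrib-+ (f ∘ decode) (g ∘ decode)

∑V-*ˡ : ∀ a (f : Vec (Fin q) m → ℕ) → ∑V (λ v → a * f v) ≡ a * ∑V f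
∑V-*ˡ a f = sym (NSum.*-distribˡ-sum a (f ∘ decode))

∑V-*ʳ : ∀ (f : Vec (Fin q) m → ℕ) a → ∑V (λ v → f v * a) ≡ ∑V f * a
∑V-*ʳ f a = sym (NSum.*-distribʳ-sum a (f ∘ decode))

∑V-const : ∀ c → ∑V {q} {m} (λ _ → c) ≡ q ^ m * c
∑V-const {q} {m} = ∑-const (q ^ m)

∑V-∑-comm : ∀ {n} (f : Vec (Fin q) m → Fin n → ℕ) → ∑V (λ v → ∑ (f v)) ≡ ∑ (λ i → ∑V (λ v → f v i))
∑V-∑-comm {q} {m} {n} f = NSum.∑-comm {q ^ m} {n} (f ∘ decode)

∑V-∑V-comm : ∀ {m′} (f : Vec (Fin q) m → Vec (Fin q) m′ → ℕ) →
  ∑V (λ v → ∑V (f v)) ≡ ∑V (λ w → ∑V (λ v → f v w))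
∑V-∑V-comm {q} {m} {m′} f = NSum.∑-comm {q ^ m} {q ^ m′} λ i j → f (decode i) (decode j)

∑V-permute : (f : Vec (Fin q) m → ℕ) (φ ψ : Vec (Fin q) m → Vec (Fin q) m) →
  (∀ v → φ (ψ v) ≡ v) → (∀ v → ψ (φ v) ≡ v) → ∑V f ≡ ∑V (f ∘ φ)
∑V-permute {q} {m} f φ ψ φψ ψφ = trans
  (NSum.sum-permute (f ∘ decode) (permutation (lift φ) (lift ψ) (inv φ ψ φψ) (inv ψ φ ψφ)))
  (∑-cong λ i → cong f (decode-encode (φ (decode i))))
  where
  lift : (Vec (Fin q) m → Vec (Fin q) m) → Fin (q ^ m) → Fin (q ^ m)
  lift χ = encode ∘ χ ∘ decode
  inv : ∀ χ ω → (∀ v → χ (ω v) ≡ v) → ∀ i → lift χ (lift ω i) ≡ i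
  inv χ ω eq i = trans (cong (encode ∘ χ) (decode-encode _)) (trans (cong encode (eq _)) (encode-decode q m i))

∑V-single : (f : Vec (Fin q) m → ℕ) → ∀ u → (∀ v → v ≢ u → f v ≡ 0) → ∑V f ≡ f u
∑V-single {q} {m} f u vanish = trans
  (∑-single (f ∘ decode) (encode u) λ i i≢ → vanish _ λ eq → i≢ (trans (sym (encode-decode q m i)) (cong encode eq)))
  (cong f (decode-encode u))

size : (Vec (Fin q) m → Bool) → ℕ
size T = ∑V (ind ∘ T)

search : (f : Vec (Fin q) m → Bool) → (∃ λ v → f v ≡ true) ⊎ (∀ v → f v ≡ false)
search f with FinP.any? (λ i → f (decode i) Bool.≟ true)
... | yes (i , fi) = inj₁ (decode i , fi)
... | no none = inj₂ λ v → ≢true⇒≡false λ fv → none (encode v , trans (cong f (decode-encode v)) fv)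

size-mono : {T U : Vec (Fin q) m → Bool} → (∀ v → T v ≡ true → U v ≡ true) → size T ≤ size U
size-mono T⊆U = ∑V-mono (ind-mono ∘ T⊆U)

size-ext : {T U : Vec (Fin q) m → Bool} → (∀ v → T v ≡ U v) → size T ≡ size U
size-ext eq = ∑V-cong (cong ind ∘ eq)

size≤ : (T : Vec (Fin q) m → Bool) → size T ≤ q ^ m
size≤ {q} {m} T = ℕₚ.≤-trans (∑V-mono (λ v → ind≤1 (T v)))
  (ℕₚ.≤-reflexive (trans (∑V-const {q} {m} 1) (ℕₚ.*-identityʳ _)))
  where
  ind≤1 : ∀ b → ind b ≤ 1
  ind≤1 true  = ℕₚ.≤-refl
  ind≤1 false = z≤n

size-complement : (T : Vec (Fin q) m → Bool) → size (not ∘ T) + size T ≡ q ^ m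
size-complement {q} {m} T = trans (sym (∑V-+ (ind ∘ not ∘ T) (ind ∘ T)))
  (trans (∑V-cong (ind-not ∘ T)) (trans (∑V-const {q} {m} 1) (ℕₚ.*-identityʳ _)))

size≤1 : (T : Vec (Fin q) m → Bool) → (∀ u v → T u ≡ true → T v ≡ true → u ≡ v) → size T ≤ 1
size≤1 {q} {m} T unique = count≤1 (T ∘ decode) λ i j Ti Tj →
  trans (sym (encode-decode q m i)) (trans (cong encode (unique _ _ Ti Tj)) (encode-decode q m j))

-- Subspaces

module Subspaces {q : ℕ} (F : FiniteField q) where

  open FieldArithmetic F

  infixl 6 _⊞_
  infixr 7 _·_

  _⊞_ : ∀ {m} → Vect F m → Vect F m → Vect F m
  _⊞_ = _⊕_ F

  _·_ : ∀ {m} → Fin q → Vect F m → Vect F m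
  _·_ = _⊙_ F

  0ᵥ : ∀ {m} → Vect F m
  0ᵥ = zeroV F

  -1# : Fin q
  -1# = -F 1#

  ⊞-zero-· : ∀ {m} (u v : Vect F m) → u ⊞ 0# · v ≡ u
  ⊞-zero-· [] [] = refl
  ⊞-zero-· (x ∷ u) (y ∷ v) =
    cong₂ _∷_ (solve 2 (λ x y → x :+ con (pos 0) :* y := x) refl x y) (⊞-zero-· u v)

  ⊞-inverse : ∀ {m} (v : Vect F m) → v ⊞ -1# · v ≡ 0ᵥ
  ⊞-inverse [] = refl
  ⊞-inverse (x ∷ v) =
    cong₂ _∷_ (solve 1 (λ x → x :+ (:- con (pos 1)) :* x := con (pos 0)) refl x) (⊞-inverse v)

  ⊞-medial : ∀ {m} a b (u u′ v : Vect F m) → (u ⊞ a · v) ⊞ (u′ ⊞ b · v) ≡ (u ⊞ u′) ⊞ (a +F b) · v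
  ⊞-medial a b [] [] [] = refl
  ⊞-medial a b (x ∷ u) (y ∷ u′) (z ∷ v) = cong₂ _∷_
    (solve 5 (λ a b x y z → (x :+ a :* z) :+ (y :+ b :* z) := (x :+ y) :+ (a :+ b) :* z) refl a b x y z)
    (⊞-medial a b u u′ v)

  ·-distrib-⊞ : ∀ {m} a b (u v : Vect F m) → a · (u ⊞ b · v) ≡ a · u ⊞ (a *F b) · v
  ·-distrib-⊞ a b [] [] = refl
  ·-distrib-⊞ a b (x ∷ u) (y ∷ v) = cong₂ _∷_
    (solve 4 (λ a b x y → a :* (x :+ b :* y) := a :* x :+ (a :* b) :* y) refl a b x y)
    (·-distrib-⊞ a b u v)

  shift-unshift : ∀ {m} a (u v : Vect F m) → (u ⊞ a · v) ⊞ (-F a) · v ≡ u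
  shift-unshift a [] [] = refl
  shift-unshift a (x ∷ u) (y ∷ v) = cong₂ _∷_
    (solve 3 (λ a x y → (x :+ a :* y) :+ (:- a) :* y := x) refl a x y) (shift-unshift a u v)

  unshift-shift : ∀ {m} a (u v : Vect F m) → (u ⊞ (-F a) · v) ⊞ a · v ≡ u
  unshift-shift a [] [] = refl
  unshift-shift a (x ∷ u) (y ∷ v) = cong₂ _∷_
    (solve 3 (λ a x y → (x :+ (:- a) :* y) :+ a :* y := x) refl a x y) (unshift-shift a u v)

  shift-difference : ∀ {m} a b (u v : Vect F m) → (u ⊞ a · v) ⊞ -1# · (u ⊞ b · v) ≡ (a +F (-F b)) · v
  shift-difference a b [] [] = refl
  shift-difference a b (x ∷ u) (y ∷ v) = cong₂ _∷_
    (solve 4 (λ a b x y → (x :+ a :* y) :+ (:- con (pos 1)) :* (x :+ b :* y) := (a :+ (:- b)) :* y) refl a b x y)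
    (shift-difference a b u v)

  ·-assoc : ∀ {m} a b (v : Vect F m) → a · (b · v) ≡ (a *F b) · v
  ·-assoc a b [] = refl
  ·-assoc a b (x ∷ v) = cong₂ _∷_ (sym (*-assoc a b x)) (·-assoc a b v)

  1#-· : ∀ {m} (v : Vect F m) → 1# · v ≡ v
  1#-· [] = refl
  1#-· (x ∷ v) = cong₂ _∷_ (*-identityˡ x) (1#-· v)

  ·-cancel : ∀ {m} {a b} (v : Vect F m) → b *F a ≡ 1# → b · (a · v) ≡ v
  ·-cancel v ba≡1 = trans (·-assoc _ _ v) (trans (cong (_· v) ba≡1) (1#-· v))

  0#-· : ∀ {m} (v : Vect F m) → 0# · v ≡ 0ᵥ
  0#-· [] = refl
  0#-· (x ∷ v) = cong₂ _∷_ (zeroˡ x) (0#-· v)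

  ·-0ᵥ : ∀ {m} a → a · 0ᵥ {m} ≡ 0ᵥ
  ·-0ᵥ {zero}  a = refl
  ·-0ᵥ {suc m} a = cong₂ _∷_ (zeroʳ a) (·-0ᵥ a)

  ⊞-comm : ∀ {m} (u v : Vect F m) → u ⊞ v ≡ v ⊞ u
  ⊞-comm [] [] = refl
  ⊞-comm (x ∷ u) (y ∷ v) = cong₂ _∷_ (+-comm x y) (⊞-comm u v)

  ⊞-rotate : ∀ {m} (u v w : Vect F m) → (u ⊞ v) ⊞ w ≡ (u ⊞ w) ⊞ v
  ⊞-rotate [] [] [] = refl
  ⊞-rotate (x ∷ u) (y ∷ v) (z ∷ w) = cong₂ _∷_
    (solve 3 (λ x y z → (x :+ y) :+ z := (x :+ z) :+ y) refl x y z) (⊞-rotate u v w)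

  2≤q : 2 ≤ q
  2≤q = distinct 0≢1
    where
    distinct : ∀ {n} {i j : Fin n} → i ≢ j → 2 ≤ n
    distinct {suc zero} {zero} {zero} i≢j = ⊥-elim (i≢j refl)
    distinct {suc (suc n)} i≢j = s≤s (s≤s z≤n)

  instance
    q≢0 : ℕ.NonZero q
    q≢0 = ℕ.>-nonZero (ℕₚ.<-trans (s≤s z≤n) 2≤q)

  q^≢0 : ∀ t → ℕ.NonZero (q ^ t)
  q^≢0 t = ℕₚ.m^n≢0 q t

  module _ {m : ℕ} where

    Sub : (Vect F m → Bool) → Set
    Sub = IsSubspace F

    sub-difference : ∀ {T u v} → Sub T → T u ≡ true → T v ≡ true → T (u ⊞ -1# · v) ≡ true
    sub-difference (_ , plus , scale) Tu Tv = plus _ _ Tu (scale _ _ Tv)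

    sub-unscale : ∀ {T a v} → Sub T → a ≢ 0# → T (a · v) ≡ true → T v ≡ true
    sub-unscale {T} {a} {v} (_ , _ , scale) a≢0 Tav with inverse a a≢0
    ... | b , ab≡1 = subst (λ x → T x ≡ true) (·-cancel v (trans (*-comm b a) ab≡1)) (scale b _ Tav)

    -- Two different shifts would differ by a nonzero multiple of `v` lying in `T`.
    shift-unique : ∀ {T u v a b} → Sub T → T v ≡ false →
      T (u ⊞ a · v) ≡ true → T (u ⊞ b · v) ≡ true → a ≡ b
    shift-unique {T} {u} {v} {a} {b} subT Tv Ta Tb with a FinP.≟ b
    ... | yes a≡b = a≡b
    ... | no a≢b = ⊥-elim (≡true≢false (sub-unscale subT (a≢b ∘ +F-cancel-neg)
      (subst (λ x → T x ≡ true) (shift-difference a b u v) (sub-difference subT Ta Tb))) Tv)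

    adj? : ∀ (T : Vect F m → Bool) v u → Dec (∃ λ a → T (u ⊞ a · v) ≡ true)
    adj? T v u = FinP.any? λ a → T (u ⊞ a · v) Bool.≟ true

    opaque
      -- For a subspace `T` this is the span of `T` and `v`, described by a single scalar so that
      -- membership is decided by a search over the field. Opacity keeps that search from unfolding.
      adj : (Vect F m → Bool) → Vect F m → Vect F m → Bool
      adj T v u = does (adj? T v u)

      adj⁺ : ∀ {T v u} a → T (u ⊞ a · v) ≡ true → adj T v u ≡ true
      adj⁺ {T} {v} {u} a Ta = dec-true (adj? T v u) (a , Ta)

      adj⁻ : ∀ {T v u} → adj T v u ≡ true → ∃ λ a → T (u ⊞ a · v) ≡ true
      adj⁻ {T} {v} {u} eq with adj? T v u
      ... | yes found = found

    adj-base : ∀ {T v u} → T u ≡ true → adj T v u ≡ true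
    adj-base {T} {v} {u} Tu = adj⁺ 0# (trans (cong T (⊞-zero-· u v)) Tu)

    adj-self : ∀ {T v} → Sub T → adj T v v ≡ true
    adj-self {T} {v} (T0 , _) = adj⁺ -1# (trans (cong T (⊞-inverse v)) T0)

    adj-sub : ∀ {T v} → Sub T → Sub (adj T v)
    adj-sub {T} {v} (T0 , plus , scale) = adj-base T0
      , (λ u u′ Au Au′ → let a , Ta = adj⁻ Au ; b , Tb = adj⁻ Au′ in
          adj⁺ (a +F b) (trans (cong T (sym (⊞-medial a b u u′ v))) (plus _ _ Ta Tb)))
      , λ b u Au → let a , Ta = adj⁻ Au in
          adj⁺ (b *F a) (trans (cong T (sym (·-distrib-⊞ b a u v))) (scale b _ Ta))

    adj-least : ∀ {D U v} → Sub U → (∀ x → D x ≡ true → U x ≡ true) → U v ≡ true →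
      ∀ x → adj D v x ≡ true → U x ≡ true
    adj-least {D} {U} {v} (_ , plus , scale) D⊆U Uv x Ax with adj⁻ Ax
    ... | a , Da = trans (cong U (sym (shift-unshift a x v))) (plus _ _ (D⊆U _ Da) (scale _ _ Uv))

    -- Steinitz exchange: the scalar a with u + av in `T` cannot be 0, and dividing by it expresses
    -- v through u.
    adj-exchange : ∀ {T u v} → Sub T → T u ≡ false → adj T v u ≡ true → adj T u v ≡ true
    adj-exchange {T} {u} {v} subT@(_ , _ , scale) Tu Au with adj⁻ Au
    ... | a , Ta with a FinP.≟ 0#
    ...   | yes refl = ⊥-elim (≡true≢false (trans (cong T (sym (⊞-zero-· u v))) Ta) Tu)
    ...   | no a≢0 with inverse a a≢0
    ...     | b , ab≡1 = adj⁺ b (trans (cong T (sym moved)) (scale b _ Ta))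
      where
      moved : b · (u ⊞ a · v) ≡ v ⊞ b · u
      moved = trans (·-distrib-⊞ b a u v) (trans (⊞-comm _ _)
        (cong (_⊞ b · u) (trans (cong (_· v) (trans (*-comm b a) ab≡1)) (1#-· v))))

    adj-comm : ∀ {T u v x} → adj (adj T u) v x ≡ true → adj (adj T v) u x ≡ true
    adj-comm {T} {u} {v} {x} Ax with adj⁻ Ax
    ... | a , Aa with adj⁻ Aa
    ...   | b , Tb = adj⁺ b (adj⁺ a (trans (cong T (⊞-rotate x (b · u) (a · v))) Tb))

    size-shift : ∀ (T : Vect F m → Bool) a v → ∑V (λ u → ind (T (u ⊞ a · v))) ≡ size T
    size-shift T a v = sym (∑V-permute (ind ∘ T) (_⊞ a · v) (_⊞ (-F a) · v)
      (λ u → unshift-shift a u v) (λ u → shift-unshift a u v))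

    -- By `shift-unique` each vector of the span has exactly one shift in `T`, so the span is
    -- partitioned into q translates of `T`.
    size-adj : ∀ {T v} → Sub T → T v ≡ false → size (adj T v) ≡ q * size T
    size-adj {T} {v} subT Tv = begin
      ∑V (λ u → ind (adj T v u))                           ≡⟨ ∑V-cong fibre ⟩
      ∑V (λ u → ∑ (λ a → ind (T (u ⊞ a · v))))             ≡⟨ ∑V-∑-comm (λ u a → ind (T (u ⊞ a · v))) ⟩
      ∑ (λ a → ∑V (λ u → ind (T (u ⊞ a · v))))             ≡⟨ (∑-cong λ a → size-shift T a v) ⟩
      ∑ {q} (λ _ → size T)                                 ≡⟨ ∑-const q (size T) ⟩
      q * size T                                           ∎
      where
      open ≡-Reasoning
      fibre : ∀ u → ind (adj T v u) ≡ ∑ (λ a → ind (T (u ⊞ a · v)))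
      fibre u with adj T v u in Au
      ... | true with adj⁻ {T} {v} Au
      ...   | a , Ta = sym (count-one a Ta λ b Tb → shift-unique subT Tv Tb Ta)
      fibre u | false = sym (count-none λ a → ≢true⇒≡false λ Ta → ≡true≢false (adj⁺ {T} a Ta) Au)

    opaque
      zeroSpace : Vect F m → Bool
      zeroSpace v = does (VecP.≡-dec FinP._≟_ v 0ᵥ)

      zeroSpace⁺ : ∀ {v} → v ≡ 0ᵥ → zeroSpace v ≡ true
      zeroSpace⁺ {v} = dec-true (VecP.≡-dec FinP._≟_ v 0ᵥ)

      zeroSpace⁻ : ∀ {v} → zeroSpace v ≡ true → v ≡ 0ᵥ
      zeroSpace⁻ {v} eq with VecP.≡-dec FinP._≟_ v 0ᵥ
      ... | yes v≡0 = v≡0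

    zeroSpace-sub : Sub zeroSpace
    zeroSpace-sub = zeroSpace⁺ refl
      , (λ u v u0 v0 → zeroSpace⁺ (trans (cong₂ _⊞_ (zeroSpace⁻ u0) (zeroSpace⁻ v0))
          (trans (cong (0ᵥ ⊞_) (sym (0#-· 0ᵥ))) (⊞-zero-· 0ᵥ 0ᵥ))))
      , λ a v v0 → zeroSpace⁺ (trans (cong (a ·_) (zeroSpace⁻ v0)) (·-0ᵥ a))

    zeroSpace-least : ∀ {T} → Sub T → ∀ v → zeroSpace v ≡ true → T v ≡ true
    zeroSpace-least {T} (T0 , _) v v0 = trans (cong T (zeroSpace⁻ v0)) T0

    size-zeroSpace : size zeroSpace ≡ 1
    size-zeroSpace = trans
      (∑V-single (ind ∘ zeroSpace) 0ᵥ λ v v≢0 → cong ind (≢true⇒≡false (v≢0 ∘ zeroSpace⁻)))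
      (cong ind (zeroSpace⁺ refl))

    size-adj-power : ∀ {T v} t → Sub T → T v ≡ false → size T ≡ q ^ t → size (adj T v) ≡ q ^ suc t
    size-adj-power t subT Tv sT = trans (size-adj subT Tv) (cong (q *_) sT)

    -- A subspace `D` of `U`, zero at the start, is enlarged by vectors of `U` until it fills `U`;
    -- each vector multiplies its size by q.
    size-power : ∀ {U} → Sub U → ∃ λ t → size U ≡ q ^ t
    size-power {U} subU = grow m 0 zeroSpace refl zeroSpace-sub size-zeroSpace (zeroSpace-least subU)
      where
      grow : ∀ s t D → t + s ≡ m → Sub D → size D ≡ q ^ t → (∀ x → D x ≡ true → U x ≡ true) →
        ∃ λ t → size U ≡ q ^ t
      grow s t D t+s subD sD D⊆U with search (λ v → U v ∧ not (D v))
      ... | inj₂ none = t , trans (size-ext λ v → bool-ext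
              (λ Uv → inD v Uv) (D⊆U v)) sD
        where
        inD : ∀ v → U v ≡ true → D v ≡ true
        inD v Uv with D v in Dv
        ... | true = refl
        ... | false = ⊥-elim (≡true≢false (∧-intro Uv (not-intro Dv)) (none v))
      -- After m steps `D` has q^m elements, so one more vector would overfill the whole space.
      grow zero t D t+0 subD sD D⊆U | inj₁ (v , found) =
        ⊥-elim (ℕₚ.<⇒≱ (ℕₚ.^-monoʳ-< q 2≤q (ℕₚ.n<1+n m)) (subst (_≤ q ^ m)
          (size-adj-power m subD (not-elim (proj₂ (∧-elim {U v} found)))
            (trans sD (cong (q ^_) (trans (sym (ℕₚ.+-identityʳ t)) t+0))))
          (size≤ (adj D v))))
      grow (suc s) t D t+s subD sD D⊆U | inj₁ (v , found) with ∧-elim {U v} found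
      ... | Uv , ¬Dv = grow s (suc t) (adj D v) (trans (sym (ℕₚ.+-suc t s)) t+s) (adj-sub subD)
        (size-adj-power t subD (not-elim ¬Dv) sD) (adj-least subU D⊆U Uv)

    -- If only the zero vector were common, the sums of a vector of `G` and a vector of `U` would be
    -- q^(g+u) distinct vectors in a space of q^m. Injectivity is used as follows: a given w has at
    -- most one x in `G` with w - x in `U`.
    intersection : ∀ {G U g u} → Sub G → Sub U → size G ≡ q ^ g → size U ≡ q ^ u → m < g + u →
      ∃ λ v → G v ≡ true × U v ≡ true × v ≢ 0ᵥ
    intersection {G} {U} {g} {u} subG subU sG sU m<g+u with search (λ v → G v ∧ (U v ∧ not (zeroSpace v)))
    ... | inj₁ (v , found) with ∧-elim {G v} found
    ...   | Gv , found′ with ∧-elim {U v} found′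
    ...     | Uv , ¬v0 = v , Gv , Uv , λ v≡0 → ≡true≢false (zeroSpace⁺ v≡0) (not-elim ¬v0)
    intersection {G} {U} {g} {u} subG subU sG sU m<g+u | inj₂ none = ⊥-elim (ℕₚ.<⇒≱ (ℕₚ.^-monoʳ-< q 2≤q m<g+u) (begin
      q ^ (g + u)                                                        ≡⟨ ℕₚ.^-distribˡ-+-* q g u ⟩
      q ^ g * q ^ u                                                      ≡⟨ cong₂ _*_ sG sU ⟨
      size G * size U                                                    ≡⟨ ∑V-*ʳ (ind ∘ G) (size U) ⟨
      ∑V (λ x → ind (G x) * size U)                                      ≡⟨ (∑V-cong λ x → cong (ind (G x) *_) (sym (size-shift U -1# x))) ⟩
      ∑V (λ x → ind (G x) * ∑V (λ w → ind (U (w ⊞ -1# · x))))            ≡⟨ (∑V-cong λ x → sym (∑V-*ˡ (ind (G x)) (λ w → ind (U (w ⊞ -1# · x))))) ⟩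
      ∑V (λ x → ∑V (λ w → ind (G x) * ind (U (w ⊞ -1# · x))))            ≡⟨ ∑V-∑V-comm (λ x w → ind (G x) * ind (U (w ⊞ -1# · x))) ⟩
      ∑V (λ w → ∑V (λ x → ind (G x) * ind (U (w ⊞ -1# · x))))            ≡⟨ (∑V-cong λ w → ∑V-cong λ x → sym (ind-∧ (G x) (U (w ⊞ -1# · x)))) ⟩
      ∑V (λ w → size (λ x → G x ∧ U (w ⊞ -1# · x)))                      ≤⟨ (∑V-mono λ w → size≤1 _ (unique w)) ⟩
      ∑V {q} {m} (λ w → 1)                                               ≡⟨ ∑V-const {q} {m} 1 ⟩
      q ^ m * 1                                                          ≡⟨ ℕₚ.*-identityʳ _ ⟩
      q ^ m                                                              ∎))
      where
      open ℕₚ.≤-Reasoning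
      trivial : ∀ v → G v ≡ true → U v ≡ true → v ≡ 0ᵥ
      trivial v Gv Uv with zeroSpace v in v0
      ... | true = zeroSpace⁻ v0
      ... | false = ⊥-elim (≡true≢false (∧-intro Gv (∧-intro Uv (not-intro v0))) (none v))
      difference : ∀ {n} (w x y : Vect F n) → (w ⊞ -1# · y) ⊞ -1# · (w ⊞ -1# · x) ≡ x ⊞ -1# · y
      difference [] [] [] = refl
      difference (a ∷ w) (b ∷ x) (c ∷ y) = cong₂ _∷_
        (solve 3 (λ a b c → (a :+ (:- con (pos 1)) :* c) :+ (:- con (pos 1)) :* (a :+ (:- con (pos 1)) :* b)
                         := b :+ (:- con (pos 1)) :* c) refl a b c)
        (difference w x y)
      equal : ∀ (x y : Vect F m) → x ⊞ -1# · y ≡ 0ᵥ → x ≡ y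
      equal x y eq = trans (sym (unshift-shift 1# x y)) (trans (cong (_⊞ 1# · y) eq)
        (trans (⊞-comm _ _) (trans (cong (1# · y ⊞_) (sym (0#-· y))) (trans (⊞-zero-· _ y) (1#-· y)))))
      unique : ∀ w x y → G x ∧ U (w ⊞ -1# · x) ≡ true → G y ∧ U (w ⊞ -1# · y) ≡ true → x ≡ y
      unique w x y found found′ with ∧-elim {G x} found | ∧-elim {G y} found′
      ... | Gx , Ux | Gy , Uy = equal x y (trivial _ (sub-difference subG Gx Gy)
        (trans (cong U (sym (difference w x y))) (sub-difference subU Uy Ux)))

    spanOf : ∀ {d} → Vec (Vect F m) d → Vect F m → Bool
    spanOf []       = zeroSpace
    spanOf (b ∷ bs) = adj (spanOf bs) b

    spanOf-sub : ∀ {d} (bs : Vec (Vect F m) d) → Sub (spanOf bs)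
    spanOf-sub []       = zeroSpace-sub
    spanOf-sub (b ∷ bs) = adj-sub (spanOf-sub bs)

    spanOf-lincomb : ∀ {d} (as : Vec (Fin q) d) bs → spanOf bs (lincomb F as bs) ≡ true
    spanOf-lincomb [] [] = zeroSpace⁺ refl
    spanOf-lincomb (a ∷ as) (b ∷ bs) = proj₁ (proj₂ (spanOf-sub (b ∷ bs))) _ _
      (proj₂ (proj₂ (spanOf-sub (b ∷ bs))) a b (adj-self (spanOf-sub bs)))
      (adj-base (spanOf-lincomb as bs))

    spanOf⁻ : ∀ {d} (bs : Vec (Vect F m) d) v → spanOf bs v ≡ true → ∃ λ as → lincomb F as bs ≡ v
    spanOf⁻ [] v v∈ = [] , sym (zeroSpace⁻ v∈)
    spanOf⁻ (b ∷ bs) v v∈ with adj⁻ v∈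
    ... | a , v+ab∈ with spanOf⁻ bs _ v+ab∈
    ...   | as , eq = (-F a) ∷ as ,
      trans (⊞-comm _ _) (trans (cong (_⊞ (-F a) · b) eq) (shift-unshift a v b))

    size-spanOf : ∀ {d} (bs : Vec (Vect F m) d) → LinIndep F bs → size (spanOf bs) ≡ q ^ d
    size-spanOf [] indep = size-zeroSpace
    size-spanOf {suc d} (b ∷ bs) indep = size-adj-power d (spanOf-sub bs)
      (≢true⇒≡false λ b∈ → let as , eq = spanOf⁻ bs b b∈ in
        0≢1 (sym (trans (sym (-‿involutive 1#)) (trans (cong -F_ (VecP.∷-injectiveˡ (indep (-1# ∷ as)
          (trans (⊞-comm _ _) (trans (cong (_⊞ -1# · b) eq) (⊞-inverse b)))))) -0#≈0#))))
      (size-spanOf bs λ as eq → VecP.∷-injectiveʳ (indep (0# ∷ as)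
        (trans (⊞-comm _ _) (trans (⊞-zero-· _ b) eq))))

    -- The bridge from bases to cardinalities: in the rest of the proof dimension t is expressed as
    -- `size T ≡ q ^ t`.
    size-HasDim : ∀ {U d} → HasDim F U d → size U ≡ q ^ d
    size-HasDim {U} (bs , indep , members) = trans
      (size-ext λ v → bool-ext
        (λ Uv → let as , eq = Equivalence.to (members v) Uv in
          subst (λ x → spanOf bs x ≡ true) eq (spanOf-lincomb as bs))
        (λ v∈ → Equivalence.from (members v) (spanOf⁻ bs v v∈)))
      (size-spanOf bs indep)

    -- Averaging over the one-step extensions of a subspace

    module _ {N : ℕ} (X : Fin N → Vect F m) (B : Fin N → Bool) where

      gain : (Vect F m → Bool) → Vect F m → ℕ
      gain T v = count (λ P → B P ∧ (adj T v (X P) ∧ not (T (X P))))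

      outside : (Vect F m → Bool) → ℕ
      outside T = count (λ P → B P ∧ not (T (X P)))

      private
        fibre : ∀ {T} → Sub T → ∀ P →
          ∑V (λ v → ind (not (T v)) * ind (B P ∧ (adj T v (X P) ∧ not (T (X P))))) + ind (B P ∧ not (T (X P))) * size T
          ≡ ind (B P ∧ not (T (X P))) * (q * size T)
        fibre {T} subT P with B P | T (X P) in TX
        ... | false | _ = trans (ℕₚ.+-identityʳ _) (trans (∑V-cong λ v → ℕₚ.*-zeroʳ (ind (not (T v)))) (trans (∑V-const {q} {m} 0) (ℕₚ.*-zeroʳ (q ^ m))))
        ... | true | true = trans (ℕₚ.+-identityʳ _) (trans
              (∑V-cong λ v → trans (cong (ind (not (T v)) *_) (trans (ind-∧ (adj T v (X P)) false) (ℕₚ.*-zeroʳ (ind (adj T v (X P)))))) (ℕₚ.*-zeroʳ (ind (not (T v)))))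
              (trans (∑V-const {q} {m} 0) (ℕₚ.*-zeroʳ (q ^ m))))
        ... | true | false = begin
          ∑V (λ v → ind (not (T v)) * ind (adj T v (X P) ∧ true)) + (size T + 0)
            ≡⟨ cong₂ _+_ (∑V-cong flip) (ℕₚ.+-identityʳ (size T)) ⟩
          ∑V (λ v → ind (adj T (X P) v ∧ not (T v))) + size T
            ≡⟨ ∑V-+ (λ v → ind (adj T (X P) v ∧ not (T v))) (ind ∘ T) ⟨
          ∑V (λ v → ind (adj T (X P) v ∧ not (T v)) + ind (T v))
            ≡⟨ ∑V-cong merge ⟩
          size (adj T (X P))
            ≡⟨ size-adj subT TX ⟩
          q * size T
            ≡⟨ ℕₚ.+-identityʳ _ ⟨
          q * size T + 0 ∎
          where
          open ≡-Reasoning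
          flip : ∀ v → ind (not (T v)) * ind (adj T v (X P) ∧ true) ≡ ind (adj T (X P) v ∧ not (T v))
          flip v = trans (sym (ind-∧ (not (T v)) _)) (cong ind (bool-ext
            (λ eq → let ¬Tv , Av = ∧-elim {not (T v)} eq in
              ∧-intro (adj-exchange subT TX (proj₁ (∧-elim Av))) ¬Tv)
            (λ eq → let AX , ¬Tv = ∧-elim {adj T (X P) v} eq in
              ∧-intro ¬Tv (∧-intro (adj-exchange subT (not-elim ¬Tv) AX) refl))))
          merge : ∀ v → ind (adj T (X P) v ∧ not (T v)) + ind (T v) ≡ ind (adj T (X P) v)
          merge v with T v in Tv
          ... | true = trans (cong (_+ 1) (trans (ind-∧ (adj T (X P) v) false) (ℕₚ.*-zeroʳ (ind (adj T (X P) v)))))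
                         (cong ind (sym (adj-base {T} {X P} Tv)))
          ... | false = trans (ℕₚ.+-identityʳ _) (trans (ind-∧ (adj T (X P) v) true) (ℕₚ.*-identityʳ _))

      -- The pairs counted consist of a vector v and a point P of `B`, both outside `T`, with P in
      -- the span of `T` and v. By exchange, for fixed P the vector v runs through the span of `T`
      -- and P minus `T`, which has q|T| - |T| elements; the subtracted term stands on the left.
      gain-double-count : ∀ {T} → Sub T →
        ∑V (λ v → ind (not (T v)) * gain T v) + outside T * size T ≡ outside T * (q * size T)
      gain-double-count {T} subT = begin
        ∑V (λ v → ind (not (T v)) * gain T v) + outside T * size T
          ≡⟨ cong₂ _+_
               (trans (∑V-cong λ v → NSum.*-distribˡ-sum (ind (not (T v))) (gained v))
                 (∑V-∑-comm (λ v P → ind (not (T v)) * ind (B P ∧ (adj T v (X P) ∧ not (T (X P)))))))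
               (NSum.*-distribʳ-sum (size T) left) ⟩
        ∑ (λ P → ∑V (λ v → ind (not (T v)) * ind (B P ∧ (adj T v (X P) ∧ not (T (X P))))))
          + ∑ (λ P → ind (B P ∧ not (T (X P))) * size T)
          ≡⟨ NSum.∑-distrib-+ {N} _ (λ P → ind (B P ∧ not (T (X P))) * size T) ⟨
        ∑ (λ P → ∑V (λ v → ind (not (T v)) * ind (B P ∧ (adj T v (X P) ∧ not (T (X P)))))
          + ind (B P ∧ not (T (X P))) * size T)
          ≡⟨ ∑-cong (fibre subT) ⟩
        ∑ (λ P → ind (B P ∧ not (T (X P))) * (q * size T))
          ≡⟨ NSum.*-distribʳ-sum (q * size T) left ⟨
        outside T * (q * size T) ∎
        where
        open ≡-Reasoning
        gained : Vect F m → Fin N → ℕ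
        gained v P = ind (B P ∧ (adj T v (X P) ∧ not (T (X P))))
        left : Fin N → ℕ
        left P = ind (B P ∧ not (T (X P)))

      -- If every v outside `T` gained at least j points, the double count would give j(q^m - q^t) ≤
      -- `outside T` (q - 1) q^t. Division by q^t turns this into the negation of the assumed bound.
      small-gain : ∀ {T t s} j → Sub T → size T ≡ q ^ t → t + s ≡ m →
        j + q * outside T < j * q ^ s + outside T → ∃ λ v → T v ≡ false × gain T v < j
      small-gain {T} {t} {s} j subT sT t+s bound with search (λ v → not (T v) ∧ does (gain T v ℕ.<? j))
      ... | inj₁ (v , found) with ∧-elim {not (T v)} found
      ...   | ¬Tv , lt = v , not-elim ¬Tv , dec⁻ (gain T v ℕ.<? j) lt
        where
        dec⁻ : ∀ {A : Set} (A? : Dec A) → does A? ≡ true → A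
        dec⁻ (yes a) _ = a
      small-gain {T} {t} {s} j subT sT t+s bound | inj₂ none =
        ⊥-elim (ℕₚ.<⇒≱ bound (ℕₚ.*-cancelʳ-≤ _ _ (q ^ t) {{q^≢0 t}} (begin
          (j * q ^ s + β) * q ^ t             ≡⟨ solveℕ 4 (λ j s β t → (j ⊛ s ⊹ β) ⊛ t ⊜ j ⊛ (t ⊛ s) ⊹ β ⊛ t) refl j (q ^ s) β (q ^ t) ⟩
          j * (q ^ t * q ^ s) + β * q ^ t     ≡⟨ cong₂ (λ x y → j * x + β * y) (trans (sym (ℕₚ.^-distribˡ-+-* q t s)) (cong (q ^_) t+s)) (sym sT) ⟩
          j * q ^ m + β * size T              ≡⟨ cong (λ x → j * x + β * size T) (size-complement T) ⟨
          j * (size (not ∘ T) + size T) + β * size T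
            ≡⟨ solveℕ 4 (λ j n s β → j ⊛ (n ⊹ s) ⊹ β ⊛ s ⊜ n ⊛ j ⊹ (j ⊛ s ⊹ β ⊛ s)) refl j (size (not ∘ T)) (size T) β ⟩
          size (not ∘ T) * j + (j * size T + β * size T)
            ≤⟨ ℕₚ.+-monoˡ-≤ _ (ℕₚ.≤-trans (ℕₚ.≤-reflexive (sym (∑V-*ʳ (ind ∘ not ∘ T) j))) (∑V-mono large)) ⟩
          Γ + (j * size T + β * size T)       ≡⟨ solveℕ 3 (λ g a b → g ⊹ (a ⊹ b) ⊜ a ⊹ (g ⊹ b)) refl Γ (j * size T) (β * size T) ⟩
          j * size T + (Γ + β * size T)       ≡⟨ cong (λ x → j * size T + x) (gain-double-count subT) ⟩
          j * size T + β * (q * size T)       ≡⟨ cong₂ (λ x y → j * x + β * (q * y)) sT sT ⟩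
          j * q ^ t + β * (q * q ^ t)         ≡⟨ solveℕ 4 (λ j t β q → j ⊛ t ⊹ β ⊛ (q ⊛ t) ⊜ (j ⊹ q ⊛ β) ⊛ t) refl j (q ^ t) β q ⟩
          (j + q * β) * q ^ t                 ∎)))
        where
        open ℕₚ.≤-Reasoning
        β = outside T
        Γ = ∑V (λ v → ind (not (T v)) * gain T v)
        large : ∀ v → ind (not (T v)) * j ≤ ind (not (T v)) * gain T v
        large v with T v in Tv
        ... | true = z≤n
        ... | false with gain T v ℕ.<? j in lt
        ...   | no ≮ = ℕₚ.+-monoˡ-≤ 0 (ℕₚ.≮⇒≥ ≮)
        ...   | yes _ = ⊥-elim (≡true≢false (∧-intro (not-intro Tv) (cong does lt)) (none v))

-- Congruences and projective points

module Congruence (p : ℕ) where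

  infix 4 _≋_
  _≋_ : ℕ → ℕ → Set
  a ≋ b = a ≡ b [mod p ]

  ≋-reflexive : ∀ {a b} → a ≡ b → a ≋ b
  ≋-reflexive eq = 0 , 0 , cong (_+ 0) eq

  ≋-refl : ∀ {a} → a ≋ a
  ≋-refl = ≋-reflexive refl

  ≋-sym : ∀ {a b} → a ≋ b → b ≋ a
  ≋-sym (s , t , eq) = t , s , sym eq


  ≋-trans : ∀ {a b c} → a ≋ b → b ≋ c → a ≋ c
  ≋-trans {a} {b} {c} (s , t , eq) (s′ , t′ , eq′) = s + s′ , t + t′ , (begin
    a + (s + s′) * p       ≡⟨ solveℕ 4 (λ a s s′ p → a ⊹ (s ⊹ s′) ⊛ p ⊜ (a ⊹ s ⊛ p) ⊹ s′ ⊛ p) refl a s s′ p ⟩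
    (a + s * p) + s′ * p   ≡⟨ cong (_+ s′ * p) eq ⟩
    (b + t * p) + s′ * p   ≡⟨ solveℕ 4 (λ b t s′ p → (b ⊹ t ⊛ p) ⊹ s′ ⊛ p ⊜ (b ⊹ s′ ⊛ p) ⊹ t ⊛ p) refl b t s′ p ⟩
    (b + s′ * p) + t * p   ≡⟨ cong (_+ t * p) eq′ ⟩
    (c + t′ * p) + t * p   ≡⟨ solveℕ 4 (λ c t t′ p → (c ⊹ t′ ⊛ p) ⊹ t ⊛ p ⊜ c ⊹ (t ⊹ t′) ⊛ p) refl c t t′ p ⟩
    c + (t + t′) * p       ∎)
    where open ≡-Reasoning

  ≋-+ : ∀ {a b c d} → a ≋ b → c ≋ d → a + c ≋ b + d
  ≋-+ {a} {b} {c} {d} (s , t , eq) (s′ , t′ , eq′) = s + s′ , t + t′ ,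
    trans (regroup a c s s′) (trans (cong₂ _+_ eq eq′) (sym (regroup b d t t′)))
    where
    regroup : ∀ a c s s′ → a + c + (s + s′) * p ≡ (a + s * p) + (c + s′ * p)
    regroup a c s s′ = solveℕ 5 (λ a c s s′ p → a ⊹ c ⊹ (s ⊹ s′) ⊛ p ⊜ (a ⊹ s ⊛ p) ⊹ (c ⊹ s′ ⊛ p)) refl a c s s′ p

  ≋-+-cancelˡ : ∀ a {b c} → a + b ≋ a + c → b ≋ c
  ≋-+-cancelˡ a {b} {c} (s , t , eq) = s , t , ℕₚ.+-cancelˡ-≡ a _ _
    (trans (sym (ℕₚ.+-assoc a b _)) (trans eq (ℕₚ.+-assoc a c _)))

  ≋-*ˡ : ∀ a {b c} → b ≋ c → a * b ≋ a * c
  ≋-*ˡ a {b} {c} (s , t , eq) = a * s , a * t ,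
    trans (regroup b s) (trans (cong (a *_) eq) (sym (regroup c t)))
    where
    regroup : ∀ b s → a * b + (a * s) * p ≡ a * (b + s * p)
    regroup b s = solveℕ 4 (λ a b s p → a ⊛ b ⊹ (a ⊛ s) ⊛ p ⊜ a ⊛ (b ⊹ s ⊛ p)) refl a b s p

  ≋-∑ : ∀ {n} {f g : Fin n → ℕ} → (∀ i → f i ≋ g i) → ∑ f ≋ ∑ g
  ≋-∑ {zero} eq = ≋-refl
  ≋-∑ {suc n} eq = ≋-+ (eq zero) (≋-∑ (eq ∘ suc))

  ∣⇒≋0 : ∀ {a} → p ∣ a → a ≋ 0
  ∣⇒≋0 (divides e eq) = 0 , e , trans (ℕₚ.+-identityʳ _) eq

  ≋⇒∣ : ∀ {a b} → a ≤ b → a ≋ b → p ∣ ∣ a - b ∣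
  ≋⇒∣ {a} {b} a≤b (s , t , eq) = ℕ∣.∣m+n∣m⇒∣n (divides s (ℕₚ.+-cancelˡ-≡ a _ _ (begin
    a + (t * p + ∣ a - b ∣)  ≡⟨ solveℕ 3 (λ a t d → a ⊹ (t ⊹ d) ⊜ (a ⊹ d) ⊹ t) refl a (t * p) ∣ a - b ∣ ⟩
    (a + ∣ a - b ∣) + t * p  ≡⟨ cong (_+ t * p) (trans (cong (a +_) (ℕₚ.m≤n⇒∣m-n∣≡n∸m a≤b)) (ℕₚ.m+[n∸m]≡n a≤b)) ⟩
    b + t * p                ≡⟨ eq ⟨
    a + s * p                ∎))) (ℕ∣.n∣m*n t)
    where open ≡-Reasoning

  ∣⇒≋ : ∀ {a b} → a ≤ b → p ∣ ∣ a - b ∣ → a ≋ b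
  ∣⇒≋ {a} {b} a≤b (divides e eq) = e , 0 , (begin
    a + e * p          ≡⟨ cong (a +_) eq ⟨
    a + ∣ a - b ∣      ≡⟨ cong (a +_) (ℕₚ.m≤n⇒∣m-n∣≡n∸m a≤b) ⟩
    a + (b ∸ a)        ≡⟨ ℕₚ.m+[n∸m]≡n a≤b ⟩
    b                  ≡⟨ ℕₚ.+-identityʳ b ⟨
    b + 0              ∎)
    where open ≡-Reasoning

  -- Euclid's lemma, applied to the product of a and the absolute difference of x and y.
  ≋-*-cancelˡ : Prime p → ∀ {a x y} → ¬ (a ≋ 0) → a * x ≋ a * y → x ≋ y
  ≋-*-cancelˡ isPrime {a} a≢0 = λ eq → cancel (ℕₚ.≤-total _ _) eq
    where
    ordered : ∀ {x y} → x ≤ y → a * x ≋ a * y → x ≋ y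
    ordered {x} {y} x≤y eq with euclidsLemma a ∣ x - y ∣ isPrime
      (subst (p ∣_) (sym (ℕₚ.*-distribˡ-∣-∣ a x y)) (≋⇒∣ (ℕₚ.*-monoʳ-≤ a x≤y) eq))
    ... | inj₁ p∣a = ⊥-elim (a≢0 (∣⇒≋0 p∣a))
    ... | inj₂ p∣d = ∣⇒≋ x≤y p∣d
    cancel : ∀ {x y} → x ≤ y ⊎ y ≤ x → a * x ≋ a * y → x ≋ y
    cancel (inj₁ x≤y) eq = ordered x≤y eq
    cancel (inj₂ y≤x) eq = ≋-sym (ordered y≤x (≋-sym eq))

  ≋0⇒∣ : ∀ {a} → a ≋ 0 → p ∣ a
  ≋0⇒∣ {a} eq = ≋⇒∣ z≤n (≋-sym eq)

lookup-injective : ∀ {a} {A : Set a} {xs : List A} → Unique xs →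
  ∀ i j → List.lookup xs i ≡ List.lookup xs j → i ≡ j
lookup-injective (x∉ ∷ _)  zero    zero    eq = refl
lookup-injective (x∉ ∷ _)  zero    (suc j) eq = ⊥-elim (All.lookup x∉ (∈P.∈-lookup j) eq)
lookup-injective (x∉ ∷ _)  (suc i) zero    eq = ⊥-elim (All.lookup x∉ (∈P.∈-lookup i) (sym eq))
lookup-injective (_ ∷ uxs) (suc i) (suc j) eq = cong suc (lookup-injective uxs i j eq)

module Points {q : ℕ} (F : FiniteField q) where

  open FieldArithmetic F
  open Subspaces F

  allVects-cons : ∀ {m} (as : List (Fin q)) (vs : List (Vect F m)) →
    List.concatMap (λ a → List.map (a ∷_) vs) as ≡ List.cartesianProductWith _∷_ as vs
  allVects-cons []       vs = refl
  allVects-cons (a ∷ as) vs = cong (List.map (a ∷_) vs List.++_) (allVects-cons as vs)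

  allVects-unique : ∀ m → Unique (allVects F m)
  allVects-unique zero    = [] ∷ []
  allVects-unique (suc m) = subst Unique (sym (allVects-cons (List.allFin q) (allVects F m)))
    (UniqueP.cartesianProductWith⁺ _∷_ VecP.∷-injective (UniqueP.allFin⁺ q) (allVects-unique m))

  ∈-allVects : ∀ {m} (v : Vect F m) → v ∈ allVects F m
  ∈-allVects []      = Any.here refl
  ∈-allVects {suc m} (x ∷ v) = subst (x ∷ v ∈_) (sym (allVects-cons (List.allFin q) (allVects F m)))
    (∈P.∈-cartesianProductWith⁺ _∷_ (∈P.∈-allFin x) (∈-allVects v))

  normalised-0ᵥ : ∀ m → normalised F (0ᵥ {m}) ≡ false
  normalised-0ᵥ zero = refl
  normalised-0ᵥ (suc m) with 0# FinP.≟ 0#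
  ... | yes _ = normalised-0ᵥ m
  ... | no 0≢0 = ⊥-elim (0≢0 refl)

  -- Both vectors have first nonzero entry 1, which forces the scalar to be 1.
  normalised-unique : ∀ {m} a (u v : Vect F m) → normalised F u ≡ true → normalised F v ≡ true →
    a · u ≡ v → u ≡ v
  normalised-unique a [] [] () _ eq
  normalised-unique a (x ∷ u) (y ∷ v) nu nv eq with VecP.∷-injective eq
  ... | refl , refl with x FinP.≟ 0#
  normalised-unique a (x ∷ u) (y ∷ v) nu nv eq | refl , refl | yes refl with a *F 0# FinP.≟ 0#
  ... | yes a0≡0 = cong₂ _∷_ (sym a0≡0) (normalised-unique a u _ nu nv refl)
  ... | no a0≢0 = ⊥-elim (a0≢0 (zeroʳ a))
  normalised-unique {suc m} a (x ∷ u) (y ∷ v) nu nv eq | refl , refl | no x≢0 with x FinP.≟ 1#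
  ... | yes refl with a *F 1# FinP.≟ 0#
  ...   | yes a1≡0 = ⊥-elim (≡true≢false nv
      (trans (cong (normalised F) (trans (cong (_· u) (trans (sym (*-identityʳ a)) a1≡0)) (0#-· u))) (normalised-0ᵥ m)))
  ...   | no _ with a *F 1# FinP.≟ 1#
  ...     | yes a1≡1 = cong₂ _∷_ (sym a1≡1)
      (sym (trans (cong (_· u) (trans (sym (*-identityʳ a)) a1≡1)) (1#-· u)))

  normalise : ∀ {m} (v : Vect F m) → v ≢ 0ᵥ → ∃ λ a → normalised F (a · v) ≡ true
  normalise [] v≢0 = ⊥-elim (v≢0 refl)
  normalise (x ∷ v) v≢0 with x FinP.≟ 0#
  ... | yes refl with normalise v (v≢0 ∘ cong (0# ∷_))
  ...   | a , na = a , lemma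
    where
    lemma : normalised F (a *F 0# ∷ a · v) ≡ true
    lemma with a *F 0# FinP.≟ 0#
    ... | yes _ = na
    ... | no a0≢0 = ⊥-elim (a0≢0 (zeroʳ a))
  normalise (x ∷ v) v≢0 | no x≢0 with inverse x x≢0
  ... | a , xa≡1 = a , lemma
    where
    ax≡1 : a *F x ≡ 1#
    ax≡1 = trans (*-comm a x) xa≡1
    lemma : normalised F (a *F x ∷ a · v) ≡ true
    lemma with a *F x FinP.≟ 0#
    ... | yes ax≡0 = ⊥-elim (0≢1 (trans (sym ax≡0) ax≡1))
    ... | no _ with a *F x FinP.≟ 1#
    ...   | yes _ = refl
    ...   | no ax≢1 = ⊥-elim (ax≢1 ax≡1)

  module PointSet (n : ℕ) where

    X : Point F n → Vect F (suc n)
    X = pt F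

    X-normalised : ∀ P → normalised F (X P) ≡ true
    X-normalised P = Equivalence.to BoolP.T-≡
      (proj₂ (∈P.∈-filter⁻ (T? ∘ normalised F) {xs = allVects F (suc n)} (∈P.∈-lookup P)))

    X-injective : ∀ P R → X P ≡ X R → P ≡ R
    X-injective = lookup-injective (UniqueP.filter⁺ (T? ∘ normalised F) (allVects-unique (suc n)))

    X-onto : ∀ v → normalised F v ≡ true → ∃ λ P → X P ≡ v
    X-onto v nv = Any.index v∈ , sym (AnyP.lookup-index v∈)
      where
      v∈ : v ∈ pointList F n
      v∈ = ∈P.∈-filter⁺ (T? ∘ normalised F) (∈-allVects v) (Equivalence.from BoolP.T-≡ nv)

    X-nonzero : ∀ P → zeroSpace (X P) ≡ false
    X-nonzero P = ≢true⇒≡false λ X0 → ≡true≢false (X-normalised P)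
      (trans (cong (normalised F) (zeroSpace⁻ X0)) (normalised-0ᵥ (suc n)))

    X-collinear : ∀ {P R} → adj zeroSpace (X R) (X P) ≡ true → P ≡ R
    X-collinear {P} {R} eq with adj⁻ eq
    ... | a , 0∈ = X-injective P R (sym (normalised-unique (-F a) (X R) (X P) (X-normalised R) (X-normalised P) (sym (begin
      X P                                    ≡⟨ shift-unshift a (X P) (X R) ⟨
      (X P ⊞ a · X R) ⊞ (-F a) · X R         ≡⟨ cong (_⊞ (-F a) · X R) (zeroSpace⁻ 0∈) ⟩
      0ᵥ ⊞ (-F a) · X R                      ≡⟨ ⊞-comm _ _ ⟩
      (-F a) · X R ⊞ 0ᵥ                      ≡⟨ cong ((-F a) · X R ⊞_) (0#-· (X R)) ⟨
      (-F a) · X R ⊞ 0# · X R                ≡⟨ ⊞-zero-· _ (X R) ⟩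
      (-F a) · X R                           ∎))))
      where open ≡-Reasoning

    X-covers : ∀ v → zeroSpace v ≡ false → ∃ λ P → adj zeroSpace v (X P) ≡ true
    X-covers v v≢0 with normalise v (λ v≡0 → ≡true≢false (zeroSpace⁺ v≡0) v≢0)
    ... | a , na with X-onto (a · v) na
    ...   | P , XP≡ = P , trans (cong (adj zeroSpace v) XP≡)
      (proj₂ (proj₂ (adj-sub zeroSpace-sub)) a v (adj-self zeroSpace-sub))

    -- This is |G| = 1 + (q - 1)β for β points, without subtraction. It is the double count with the
    -- zero space as `T` and the points of `G` as the point set.
    size-count : ∀ {G : Vect F (suc n) → Bool} → Sub G → size G + count (G ∘ X) ≡ 1 + q * count (G ∘ X)
    size-count {G} subG = begin
      size G + β                                     ≡⟨ cong (_+ β) (trans (∑V-cong split) (∑V-+ (λ v → ind (not (zeroSpace′ v)) * gain X (G ∘ X) zeroSpace v) (ind ∘ zeroSpace′))) ⟩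
      (∑V (λ v → ind (not (zeroSpace v)) * gain X (G ∘ X) zeroSpace v) + size zeroSpace′) + β
        ≡⟨ ℕₚ.+-assoc _ (size zeroSpace′) β ⟩
      Γ + (size zeroSpace′ + β)                      ≡⟨ cong (Γ +_) (ℕₚ.+-comm (size zeroSpace′) β) ⟩
      Γ + (β + size zeroSpace′)                      ≡⟨ ℕₚ.+-assoc Γ β _ ⟨
      (Γ + β) + size zeroSpace′                      ≡⟨ cong₂ _+_ counted (size-zeroSpace {suc n}) ⟩
      q * β + 1                                      ≡⟨ ℕₚ.+-comm (q * β) 1 ⟩
      1 + q * β                                      ∎
      where
      open ≡-Reasoning
      zeroSpace′ : Vect F (suc n) → Bool
      zeroSpace′ = zeroSpace
      β = count (G ∘ X)
      Γ = ∑V (λ v → ind (not (zeroSpace′ v)) * gain X (G ∘ X) zeroSpace v)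
      outside≡β : outside X (G ∘ X) zeroSpace ≡ β
      outside≡β = ∑-cong λ P → cong ind (trans (cong (λ b → G (X P) ∧ not b) (X-nonzero P)) (BoolP.∧-identityʳ _))
      counted : Γ + β ≡ q * β
      counted = begin
        Γ + β                                                       ≡⟨ cong (Γ +_) (trans (cong₂ _*_ outside≡β (size-zeroSpace {suc n})) (ℕₚ.*-identityʳ β)) ⟨
        Γ + outside X (G ∘ X) zeroSpace * size zeroSpace′           ≡⟨ gain-double-count X (G ∘ X) zeroSpace-sub ⟩
        outside X (G ∘ X) zeroSpace * (q * size zeroSpace′)         ≡⟨ cong₂ (λ x y → x * (q * y)) outside≡β (size-zeroSpace {suc n}) ⟩
        β * (q * 1)                                                 ≡⟨ cong (β *_) (ℕₚ.*-identityʳ q) ⟩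
        β * q                                                       ≡⟨ ℕₚ.*-comm β q ⟩
        q * β                                                       ∎
      -- The multiples of a nonzero v contain exactly one normalised vector, and it lies in `G`
      -- exactly when v does.
      lineGain : ∀ v → zeroSpace v ≡ false → gain X (G ∘ X) zeroSpace v ≡ ind (G v)
      lineGain v v≢0 with G v in Gv | X-covers v v≢0
      ... | true | P , vP = count-one P
            (∧-intro (adj-least subG (zeroSpace-least subG) Gv _ vP) (∧-intro vP (not-intro (X-nonzero P))))
            λ R found → X-collinear (adj-least (adj-sub zeroSpace-sub) (zeroSpace-least (adj-sub zeroSpace-sub))
              (adj-exchange zeroSpace-sub (X-nonzero P) vP) _
              (proj₁ (∧-elim (proj₂ (∧-elim {G (X R)} found)))))
      ... | false | _ = count-none λ P → ≢true⇒≡false λ found → ≡true≢false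
            (adj-least subG (zeroSpace-least subG) (proj₁ (∧-elim {G (X P)} found)) v
              (adj-exchange zeroSpace-sub (X-nonzero P) (proj₁ (∧-elim (proj₂ (∧-elim {G (X P)} found)))))) Gv
      split : ∀ v → ind (G v) ≡ ind (not (zeroSpace v)) * gain X (G ∘ X) zeroSpace v + ind (zeroSpace v)
      split v with zeroSpace v in v0
      ... | true = cong ind (zeroSpace-least subG v v0)
      ... | false = sym (trans (ℕₚ.+-identityʳ _) (trans (ℕₚ.+-identityʳ _) (lineGain v v0)))

    module _ {p : ℕ} where
      open Congruence p

      -- In `size-count` both |G|, a positive power of q, and qβ vanish modulo p, which leaves β ≡
      -- 1; the vector v excludes the zero space.
      count≋1 : p ∣ q → ∀ {G : Vect F (suc n) → Bool} {v} → Sub G → G v ≡ true → v ≢ 0ᵥ → count (G ∘ X) ≋ 1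
      count≋1 p∣q {G} {v} subG Gv v≢0 with size-power subG
      ... | zero , sG = ⊥-elim (ℕₚ.<⇒≱ (subst (1 <_) (sym (size-adj-power 0 zeroSpace-sub v∉0 (size-zeroSpace {suc n}))) 1<q^1)
              (subst (size (adj zeroSpace v) ≤_) sG (size-mono (adj-least subG (zeroSpace-least subG) Gv))))
        where
        v∉0 : zeroSpace v ≡ false
        v∉0 = ≢true⇒≡false (v≢0 ∘ zeroSpace⁻)
        1<q^1 : 1 < q ^ 1
        1<q^1 = subst (1 <_) (sym (ℕₚ.*-identityʳ q)) 2≤q
      count≋1 (divides e q≡e*p) {G} {v} subG Gv v≢0 | suc t , sG = e * q ^ t , e * β , (begin
        β + (e * q ^ t) * p              ≡⟨ solveℕ 4 (λ b e y p → b ⊹ (e ⊛ y) ⊛ p ⊜ (e ⊛ p) ⊛ y ⊹ b) refl β e (q ^ t) p ⟩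
        (e * p) * q ^ t + β              ≡⟨ cong (λ x → x * q ^ t + β) q≡e*p ⟨
        q ^ suc t + β                    ≡⟨ cong (_+ β) sG ⟨
        size G + β                       ≡⟨ size-count subG ⟩
        1 + q * β                        ≡⟨ cong (λ x → 1 + x * β) q≡e*p ⟩
        1 + (e * p) * β                  ≡⟨ cong suc (solveℕ 3 (λ b e p → (e ⊛ p) ⊛ b ⊜ (e ⊛ b) ⊛ p) refl β e p) ⟩
        1 + (e * β) * p                  ∎)
        where
        open ≡-Reasoning
        β = count (G ∘ X)

-- The support of a codeword

module Coordinates {q : ℕ} (F : FiniteField q) {m : ℕ} where
  open FieldArithmetic F
  open Subspaces F

  shear : ∀ {m} a b a′ b′ (x r s w : Vect F m) →
    (x ⊞ b · (s ⊞ b′ · w)) ⊞ a · (r ⊞ a′ · w) ≡ ((x ⊞ (b *F b′ +F a *F a′) · w) ⊞ b · s) ⊞ a · r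
  shear a b a′ b′ [] [] [] [] = refl
  shear a b a′ b′ (x ∷ xs) (r ∷ rs) (s ∷ ss) (w ∷ ws) = cong₂ _∷_
    (solve 8 (λ a b a′ b′ x r s w →
      (x :+ b :* (s :+ b′ :* w)) :+ a :* (r :+ a′ :* w) :=
      ((x :+ (b :* b′ :+ a :* a′) :* w) :+ b :* s) :+ a :* r) refl a b a′ b′ x r s w)
    (shear a b a′ b′ xs rs ss ws)

  module _ {T₁ : Vect F m → Bool} {r s w : Vect F m} (sub : Sub T₁) (r∉ : T₁ r ≡ false)
    (s∉ : adj T₁ r s ≡ false) (w∉ : adj (adj T₁ r) s w ≡ false) where

    -- Modulo `T₁` the vectors r, s, w are independent, and z, y, u are the negated coordinates of x
    -- along w, s, r. They are peeled off one at a time by `shift-unique`, starting with w.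
    coordinates-unique : ∀ {x z y u z′ y′ u′} →
      T₁ (((x ⊞ z · w) ⊞ y · s) ⊞ u · r) ≡ true → T₁ (((x ⊞ z′ · w) ⊞ y′ · s) ⊞ u′ · r) ≡ true →
      z ≡ z′ × y ≡ y′ × u ≡ u′
    coordinates-unique {x} {z} {y} {u} {z′} {y′} {u′} ∈T ∈T′
      with refl ← shift-unique {T = adj (adj T₁ r) s} {u = x} {v = w} {a = z} {b = z′} (adj-sub (adj-sub sub)) w∉
                    (adj⁺ y (adj⁺ u ∈T)) (adj⁺ y′ (adj⁺ u′ ∈T′))
      with refl ← shift-unique {T = adj T₁ r} {u = x ⊞ z · w} {v = s} {a = y} {b = y′} (adj-sub sub) s∉
                    (adj⁺ u ∈T) (adj⁺ u′ ∈T′)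
      = refl , refl , shift-unique sub r∉ ∈T ∈T′

    coordinates-0 : T₁ (((0ᵥ ⊞ 0# · w) ⊞ 0# · s) ⊞ 0# · r) ≡ true
    coordinates-0 = trans (cong T₁ (trans (⊞-zero-· _ r) (trans (⊞-zero-· _ s) (⊞-zero-· _ w)))) (proj₁ sub)

    coordinates-r : T₁ (((r ⊞ 0# · w) ⊞ 0# · s) ⊞ -1# · r) ≡ true
    coordinates-r = trans (cong T₁ (trans (cong (_⊞ -1# · r) (trans (⊞-zero-· _ s) (⊞-zero-· _ w))) (⊞-inverse r))) (proj₁ sub)

    coordinates-s : T₁ (((s ⊞ 0# · w) ⊞ -1# · s) ⊞ 0# · r) ≡ true
    coordinates-s = trans (cong T₁ (trans (⊞-zero-· _ r) (trans (cong (_⊞ -1# · s) (⊞-zero-· _ w)) (⊞-inverse s)))) (proj₁ sub)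

    module _ (α β : Fin q) where
      r′ s′ : Vect F m
      r′ = r ⊞ (-F α) · w
      s′ = s ⊞ (-F β) · w

      -- In the span of `T₁`, r, s, w this is the hyperplane z + αu + βy = 0 in the coordinates
      -- above; α = β = 0 gives back the span of `T₁`, r and s.
      sheared : Vect F m → Bool
      sheared = adj (adj T₁ r′) s′

      sheared⁻ : ∀ {x} → sheared x ≡ true →
        ∃₂ λ y u → T₁ (((x ⊞ (y *F (-F β) +F u *F (-F α)) · w) ⊞ y · s) ⊞ u · r) ≡ true
      sheared⁻ {x} x∈ with adj⁻ x∈
      ... | y , x+ys∈ with adj⁻ x+ys∈
      ...   | u , ∈T = y , u , trans (cong T₁ (sym (shear u y (-F α) (-F β) x r s w))) ∈T

      private
        0ᵥ-⊞ : ∀ {m} (x : Vect F m) → 0ᵥ ⊞ x ≡ x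
        0ᵥ-⊞ [] = refl
        0ᵥ-⊞ (x ∷ xs) = cong₂ _∷_ (+-identityˡ x) (0ᵥ-⊞ xs)

      -- Otherwise the zero vector would have the coordinates (-α, 0, 1) besides (0, 0, 0).
      r′∉ : T₁ r′ ≡ false
      r′∉ = ≢true⇒≡false λ ∈T → 0≢1 (sym (proj₂ (proj₂ (coordinates-unique
        (trans (cong T₁ (trans (sym (shear 1# 0# (-F α) (-F β) 0ᵥ r s w))
          (trans (cong₂ _⊞_ (⊞-zero-· 0ᵥ _) (1#-· r′)) (0ᵥ-⊞ r′)))) ∈T)
        coordinates-0))))

      s′∉ : adj T₁ r′ s′ ≡ false
      s′∉ = ≢true⇒≡false λ s′∈ → let u , ∈T = adj⁻ s′∈ in
        0≢1 (sym (proj₁ (proj₂ (coordinates-unique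
          (trans (cong T₁ (trans (sym (shear u 1# (-F α) (-F β) 0ᵥ r s w))
            (cong (_⊞ u · r′) (trans (0ᵥ-⊞ _) (1#-· s′))))) ∈T)
          coordinates-0))))

      neg-zero : ∀ {x} → -1# *F (-F x) ≡ 0# → x ≡ 0#
      neg-zero {x} eq = trans (solve 1 (λ x → x := (:- con (pos 1)) :* (:- x)) refl x) eq

      -- The coordinates of r are (0, 0, -1), while membership makes the entry along w equal to α.
      r∈sheared : sheared r ≡ true → α ≡ 0#
      r∈sheared r∈ with sheared⁻ r∈
      ... | y , u , ∈T with coordinates-unique ∈T coordinates-r
      ...   | z≡0 , refl , refl = neg-zero (trans
        (solve 2 (λ a b → a := con (pos 0) :* b :+ a) refl _ (-F β)) z≡0)

      s∈sheared : sheared s ≡ true → β ≡ 0#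
      s∈sheared s∈ with sheared⁻ s∈
      ... | y , u , ∈T with coordinates-unique ∈T coordinates-s
      ...   | z≡0 , refl , refl = neg-zero (trans
        (solve 2 (λ a b → a := a :+ con (pos 0) :* b) refl _ (-F α)) z≡0)

-- Inequalities for the averaging argument

module _ {q β K : ℕ} where

  -- The hypothesis of `small-gain` for no new point at codimension k + 2, with `K` standing for
  -- q^k.
  extension-bound : 2 ≤ q → β < 2 * K → 1 + q * β < 1 * (q * (q * K)) + β
  extension-bound 2≤q β< = begin-strict
    1 + q * β              <⟨ ℕₚ.+-monoˡ-< (q * β) 2≤q ⟩
    q + q * β              ≡⟨ ℕₚ.*-suc q β ⟨
    q * suc β              ≤⟨ ℕₚ.*-monoʳ-≤ q (ℕₚ.≤-trans β< (ℕₚ.*-monoˡ-≤ K 2≤q)) ⟩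
    q * (q * K)            ≡⟨ ℕₚ.*-identityˡ _ ⟨
    1 * (q * (q * K))      ≤⟨ ℕₚ.m≤m+n _ β ⟩
    1 * (q * (q * K)) + β  ∎
    where open ℕₚ.≤-Reasoning

  -- The case of at most one new point at codimension k + 1; q ≥ 3 absorbs the additive 2.
  secant-bound : 3 ≤ q → β < 2 * K → 2 + q * β < 2 * (q * K) + β
  secant-bound 3≤q β< = begin-strict
    2 + q * β              <⟨ ℕₚ.+-monoˡ-< (q * β) 3≤q ⟩
    q + q * β              ≡⟨ ℕₚ.*-suc q β ⟨
    q * suc β              ≤⟨ ℕₚ.*-monoʳ-≤ q β< ⟩
    q * (2 * K)            ≡⟨ solveℕ 2 (λ q K → q ⊛ (conℕ 2 ⊛ K) ⊜ conℕ 2 ⊛ (q ⊛ K)) refl q K ⟩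
    2 * (q * K)            ≤⟨ ℕₚ.m≤m+n _ β ⟩
    2 * (q * K) + β        ∎
    where open ℕₚ.≤-Reasoning

  -- Here `suc r + suc r` is 2(q - 1), and after division by q - 1 the inequality is exactly 2 + β <
  -- 2K.
  plane-bound : ∀ r → suc (suc r) ≡ q → 2 + β < 2 * K →
    (suc r + suc r) + q * β < (suc r + suc r) * K + β
  plane-bound r refl β< = begin-strict
    (ρ + ρ) + suc ρ * β    ≡⟨ solveℕ 2 (λ ρ β → (ρ ⊹ ρ) ⊹ (conℕ 1 ⊹ ρ) ⊛ β ⊜ ρ ⊛ (conℕ 2 ⊹ β) ⊹ β) refl ρ β ⟩
    ρ * (2 + β) + β        <⟨ ℕₚ.+-monoˡ-< β (ℕₚ.*-monoʳ-< ρ β<) ⟩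
    ρ * (2 * K) + β        ≡⟨ cong (_+ β) (solveℕ 2 (λ ρ K → ρ ⊛ (conℕ 2 ⊛ K) ⊜ (ρ ⊹ ρ) ⊛ K) refl ρ K) ⟩
    (ρ + ρ) * K + β        ∎
    where
    open ℕₚ.≤-Reasoning
    ρ = suc r

-- Codewords with a constant value on large subspaces

module ConstantCodeword
  -- In vector terms an (n - k)-space has dimension r + 2, so that r is left for the part `T₁`
  -- complementary to a line in it.
  {q : ℕ} (F : FiniteField q) (p n k r : ℕ) (3≤q : 3 ≤ q) (n≡ : suc n ≡ r + suc (suc k))
  (c : Point F n → ℕ) (a : ℕ)
  -- Since t is a vector dimension, `n < k + t` means projective dimension at least n - k.
  (constant : ∀ {T t} → IsSubspace F T → size T ≡ q ^ t → n < k + t →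
    ∑ (λ P → ind (T (pt F {n} P)) * c P) ≡ a [mod p ])
  (a≢0 : ¬ (a ≡ 0 [mod p ]))
  (small : count (inSupp F p {n} c) < 2 * q ^ k)
  where

  open FieldArithmetic F
  open Subspaces F
  open Points F
  open PointSet n
  open Congruence p

  Space : Set
  Space = Vect F (suc n) → Bool

  B : Point F n → Bool
  B = inSupp F p {n} c

  B-false : ∀ {P} → B P ≡ false → c P ≋ 0
  B-false {P} BP with p ∣? c P
  ... | yes p∣c = ∣⇒≋0 p∣c

  B-true : ∀ {P} → B P ≡ true → ¬ (c P ≋ 0)
  B-true {P} BP c≋0 with p ∣? c P
  ... | no p∤c = p∤c (≋0⇒∣ c≋0)

  inside : Space → ℕ
  inside T = count (λ P → T (X P) ∧ B P)

  inside+outside : ∀ T → count B ≡ inside T + outside X B T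
  inside+outside T = count-+ {g = λ P → T (X P) ∧ B P} λ P → split (T (X P)) (B P)
    where
    split : ∀ t b → ind b ≡ ind (t ∧ b) + ind (b ∧ not t)
    split true  true  = refl
    split true  false = refl
    split false true  = refl
    split false false = refl

  outside<2q^k : ∀ T → outside X B T < 2 * q ^ k
  outside<2q^k T = ℕₚ.≤-<-trans (ℕₚ.m≤n+m _ (inside T)) (subst (_< 2 * q ^ k) (inside+outside T) small)

  inside-adj : ∀ T v → inside (adj T v) ≡ inside T + gain X B T v
  inside-adj T v = count-+ {g = λ P → T (X P) ∧ B P} λ P →
    split (T (X P)) (adj T v (X P)) (B P) adj-base
    where
    split : ∀ t t′ b → (t ≡ true → t′ ≡ true) → ind (t′ ∧ b) ≡ ind (t ∧ b) + ind (b ∧ (t′ ∧ not t))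
    split true  t′ b t⇒t′ rewrite t⇒t′ refl = sym (trans (cong (ind b +_) (cong ind (BoolP.∧-zeroʳ b))) (ℕₚ.+-identityʳ _))
    split false t′ b _ = cong ind (trans (BoolP.∧-comm t′ b) (cong (b ∧_) (sym (BoolP.∧-identityʳ t′))))

  δ : Point F n → ℕ → Point F n → ℕ
  δ R x P = ind (does (P FinP.≟ R)) * x

  δ-self : ∀ R x → δ R x R ≡ x
  δ-self R x = trans (cong (λ b → ind b * x) (dec-true (R FinP.≟ R) refl)) (ℕₚ.*-identityˡ x)

  δ-other : ∀ {R P} x → P ≢ R → δ R x P ≡ 0
  δ-other {R} {P} x P≢R = cong (λ b → ind b * x) (dec-false (P FinP.≟ R) P≢R)

  ∑-δ : ∀ R x → ∑ (δ R x) ≡ x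
  ∑-δ R x = trans (∑-single (δ R x) R λ P → δ-other x) (δ-self R x)

  inner-two : ∀ (T : Space) {R Q} → R ≢ Q → (∀ P → B P ≡ true → T (X P) ≡ true → P ≡ R ⊎ P ≡ Q) →
    ∑ (λ P → ind (T (X P)) * c P) ≋ ind (T (X R)) * c R + ind (T (X Q)) * c Q
  inner-two T {R} {Q} R≢Q only = ≋-trans (≋-∑ pointwise)
    (≋-reflexive (trans (NSum.∑-distrib-+ (δ R x) (δ Q y)) (cong₂ _+_ (∑-δ R x) (∑-δ Q y))))
    where
    x y : ℕ
    x = ind (T (X R)) * c R
    y = ind (T (X Q)) * c Q
    vanish : ∀ P → P ≢ R → P ≢ Q → ind (T (X P)) * c P ≋ 0
    vanish P P≢R P≢Q with T (X P) in TP
    ... | false = ≋-refl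
    ... | true with B P in BP
    ...   | false = ≋-trans (≋-reflexive (ℕₚ.*-identityˡ _)) (B-false BP)
    ...   | true with only P BP TP
    ...     | inj₁ P≡R = ⊥-elim (P≢R P≡R)
    ...     | inj₂ P≡Q = ⊥-elim (P≢Q P≡Q)
    pointwise : ∀ P → ind (T (X P)) * c P ≋ δ R x P + δ Q y P
    pointwise P with P FinP.≟ R | P FinP.≟ Q
    ... | yes refl | yes refl = ⊥-elim (R≢Q refl)
    ... | yes refl | no P≢Q = ≋-reflexive (sym (trans (ℕₚ.+-identityʳ _) (ℕₚ.*-identityˡ x)))
    ... | no P≢R | yes refl = ≋-reflexive (sym (ℕₚ.*-identityˡ y))
    ... | no P≢R | no P≢Q = vanish P P≢R P≢Q

  inner-one : ∀ (T : Space) {R} → T (X R) ≡ true → (∀ P → B P ≡ true → T (X P) ≡ true → P ≡ R) →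
    ∑ (λ P → ind (T (X P)) * c P) ≋ c R
  inner-one T {R} TR only = ≋-trans (≋-∑ pointwise) (≋-reflexive (∑-δ R (c R)))
    where
    pointwise : ∀ P → ind (T (X P)) * c P ≋ δ R (c R) P
    pointwise P with P FinP.≟ R
    ... | yes refl = ≋-reflexive (cong (λ b → ind b * c P) TR)
    ... | no P≢R with T (X P) in TP
    ...   | false = ≋-refl
    ...   | true with B P in BP
    ...     | false = ≋-trans (≋-reflexive (ℕₚ.*-identityˡ _)) (B-false BP)
    ...     | true = ⊥-elim (P≢R (only P BP TP))

  n<k+r+2 : n < k + suc (suc r)
  n<k+r+2 = ℕₚ.≤-reflexive (trans n≡ (solveℕ 2 (λ r k → r ⊹ (conℕ 2 ⊹ k) ⊜ k ⊹ (conℕ 2 ⊹ r)) refl r k))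

  -- A subspace S meeting the support in R and Q only is tilted about a complement T₁ of the
  -- line RQ inside a subspace of one dimension more, until it misses R or Q and gains no
  -- other point.
  module Secant {R Q : Point F n} (BR : B R ≡ true) (BQ : B Q ≡ true) {T₁ : Space}
    (sub₁ : Sub T₁) (s₁ : size T₁ ≡ q ^ r) (R∉ : T₁ (X R) ≡ false) (Q∉ : adj T₁ (X R) (X Q) ≡ false)
    (only : ∀ P → B P ≡ true → adj (adj T₁ (X R)) (X Q) (X P) ≡ true → P ≡ R ⊎ P ≡ Q) where

    S : Space
    S = adj (adj T₁ (X R)) (X Q)

    subS : Sub S
    subS = adj-sub (adj-sub sub₁)

    sizeS : size S ≡ q ^ suc (suc r)
    sizeS = size-adj-power (suc r) (adj-sub sub₁) Q∉ (size-adj-power r sub₁ R∉ s₁)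

    R∈S : S (X R) ≡ true
    R∈S = adj-base (adj-self sub₁)

    Q∈S : S (X Q) ≡ true
    Q∈S = adj-self (adj-sub sub₁)

    R≢Q : R ≢ Q
    R≢Q refl = ≡true≢false (adj-self sub₁) Q∉

    R+Q≋a : c R + c Q ≋ a
    R+Q≋a = ≋-trans (≋-reflexive (sym (cong₂ _+_
        (trans (cong (λ b → ind b * c R) R∈S) (ℕₚ.*-identityˡ _))
        (trans (cong (λ b → ind b * c Q) Q∈S) (ℕₚ.*-identityˡ _)))))
      (≋-trans (≋-sym (inner-two S R≢Q only)) (constant subS sizeS n<k+r+2))

    two : inside S ≡ 2
    two = trans (∑-cong pointwise) (trans (NSum.∑-distrib-+ (δ R 1) (δ Q 1)) (cong₂ _+_ (∑-δ R 1) (∑-δ Q 1)))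
      where
      pointwise : ∀ P → ind (S (X P) ∧ B P) ≡ δ R 1 P + δ Q 1 P
      pointwise P with P FinP.≟ R | P FinP.≟ Q
      ... | yes refl | yes refl = ⊥-elim (R≢Q refl)
      ... | yes refl | no _ = cong ind (∧-intro R∈S BR)
      ... | no _ | yes refl = cong ind (∧-intro Q∈S BQ)
      ... | no P≢R | no P≢Q = cong ind (≢true⇒≡false λ found → let P∈S , BP = ∧-elim {S (X P)} found in
        excluded (only P BP P∈S))
        where
        excluded : P ≡ R ⊎ P ≡ Q → ⊥
        excluded (inj₁ P≡R) = P≢R P≡R
        excluded (inj₂ P≡Q) = P≢Q P≡Q

    module Plane {w : Vect F (suc n)} (w∉S : S w ≡ false) {ρ : ℕ} (ρ≡ : suc (suc ρ) ≡ q)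
      (gain< : gain X B S w < suc ρ + suc ρ) where

      new : Point F n → Bool
      new P = B P ∧ (adj S w (X P) ∧ not (S (X P)))

      open Coordinates F {suc n} using (coordinates-unique; sheared; sheared⁻; r′∉; s′∉; r∈sheared; s∈sheared)

      place : Fin q × Fin q × Fin q → Vect F (suc n) → Vect F (suc n)
      place (x , y , z) v = ((v ⊞ z · w) ⊞ y · X Q) ⊞ x · X R

      opaque
        choose : ∀ P → Σ (Fin q × Fin q × Fin q) λ l → new P ≡ true → T₁ (place l (X P)) ≡ true
        choose P with new P in newP
        -- A default for points that are not new; it never reaches `forms`, which is filtered by
        -- `new`.
        ... | false = (0# , 0# , 0#) , λ ()
        ... | true with adj⁻ (proj₁ (∧-elim {adj S w (X P)} (proj₂ (∧-elim {B P} newP))))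
        ...   | z , ∈S with adj⁻ ∈S
        ...     | y , ∈TR with adj⁻ ∈TR
        ...       | x , ∈T = (x , y , z) , λ _ → ∈T

      form : Point F n → Fin q × Fin q × Fin q
      form P = proj₁ (choose P)

      forms : List (Fin q × Fin q × Fin q)
      forms = List.map form (List.filterᵇ new (List.allFin _))

      forms-bound : suc (suc (length forms)) < q + q
      forms-bound = subst₂ (λ l u → suc (suc l) < u)
        (sym (trans (ListP.length-map form (List.filterᵇ new (List.allFin _))) (length-filterᵇ new (λ P → P))))
        (trans (cong suc (sym (ℕₚ.+-suc (suc ρ) (suc ρ)))) (cong₂ _+_ ρ≡ ρ≡))
        (s≤s (s≤s gain<))

      -- At the origin the form takes the value z, and z = 0 would put the point in `S`.
      form-origin : ∀ {P} → new P ≡ true → formValue 0# 0# (form P) ≢ 0#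
      form-origin {P} newP value≡0 = ≡true≢false
        (adj⁺ y (adj⁺ x (trans (cong (λ u → T₁ ((u ⊞ y · X Q) ⊞ x · X R))
          (trans (sym (⊞-zero-· (X P) w)) (cong (λ u → X P ⊞ u · w) (sym z≡0)))) (proj₂ (choose P) newP))))
        (not-elim (proj₂ (∧-elim {adj S w (X P)} (proj₂ (∧-elim {B P} newP)))))
        where
        x y z : Fin q
        x = proj₁ (form P)
        y = proj₁ (proj₂ (form P))
        z = proj₂ (proj₂ (form P))
        z≡0 : z ≡ 0#
        z≡0 = trans (solve 3 (λ x y z → z := z :+ (con (pos 0) :* x :+ con (pos 0) :* y)) refl x y z) value≡0

      forms-origin : All (λ l → formValue 0# 0# l ≢ 0#) forms
      forms-origin = AllP.map⁺ (All.tabulate λ {P} P∈ → form-origin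
        (Equivalence.to BoolP.T-≡ (proj₂ (∈P.∈-filter⁻ (T? ∘ new) {xs = List.allFin _} P∈))))

      module Tilt (α β : Fin q) (αβ≢0 : ¬ (α ≡ 0# × β ≡ 0#)) (nonzero : All (λ l → formValue α β l ≢ 0#) forms) where

        S′ : Space
        S′ = sheared sub₁ R∉ Q∉ w∉S α β

        -- By uniqueness the chosen coordinates of the point are those witnessing membership in the
        -- tilted space, whose equation is this form. A tilt at which no form vanishes therefore
        -- gains no new point.
        form-vanishes : ∀ {P y x} → new P ≡ true →
          T₁ (place (x , y , y *F (-F β) +F x *F (-F α)) (X P)) ≡ true → formValue α β (form P) ≡ 0#
        form-vanishes {P} {y} {x} newP ∈T = trans
          (cong (formValue α β) (cong₂ _,_ (proj₂ (proj₂ same)) (cong₂ _,_ (proj₁ (proj₂ same)) (proj₁ same))))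
          (solve 4 (λ x y α β → (y :* (:- β) :+ x :* (:- α)) :+ (α :* x :+ β :* y) := con (pos 0)) refl x y α β)
          where
          same = coordinates-unique sub₁ R∉ Q∉ w∉S (proj₂ (choose P) newP) ∈T

        form∈forms : ∀ {P} → new P ≡ true → form P ∈ forms
        form∈forms {P} newP = ∈P.∈-map⁺ form
          (∈P.∈-filter⁺ (T? ∘ new) (∈P.∈-allFin P) (Equivalence.from BoolP.T-≡ newP))

        only′ : ∀ P → B P ≡ true → S′ (X P) ≡ true → P ≡ R ⊎ P ≡ Q
        only′ P BP P∈S′ with S (X P) in P∈S
        ... | true = only P BP P∈S
        ... | false = let y , x , ∈T = sheared⁻ sub₁ R∉ Q∉ w∉S α β P∈S′
                          newP = ∧-intro BP (∧-intro (adj⁺ _ (adj⁺ y (adj⁺ x ∈T))) (not-intro P∈S))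
                      in ⊥-elim (All.lookup nonzero (form∈forms newP) (form-vanishes newP ∈T))

        sum≋a : ind (S′ (X R)) * c R + ind (S′ (X Q)) * c Q ≋ a
        sum≋a = ≋-trans (≋-sym (inner-two S′ R≢Q only′)) (constant (adj-sub (adj-sub sub₁))
          (size-adj-power (suc r) (adj-sub sub₁) (s′∉ sub₁ R∉ Q∉ w∉S α β)
            (size-adj-power r sub₁ (r′∉ sub₁ R∉ Q∉ w∉S α β) s₁)) n<k+r+2)

        -- Containing both `R` and `Q` would mean α = β = 0, and containing neither would give a ≡
        -- 0. Containing only `Q` would give c Q ≡ a ≡ c R + c Q, hence c R ≡ 0.
        cases : ∀ b b′ → S′ (X R) ≡ b → S′ (X Q) ≡ b′ → ind b * c R + ind b′ * c Q ≋ a → c R ≋ a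
        cases true true R∈ Q∈ _ = ⊥-elim (αβ≢0
          (r∈sheared sub₁ R∉ Q∉ w∉S α β R∈ , s∈sheared sub₁ R∉ Q∉ w∉S α β Q∈))
        cases true false _ _ eq = ≋-trans
          (≋-reflexive (sym (trans (ℕₚ.+-identityʳ _) (ℕₚ.*-identityˡ _)))) eq
        cases false true _ _ eq = ⊥-elim (B-true BR (≋-+-cancelˡ (c Q)
          (≋-trans (≋-reflexive (ℕₚ.+-comm (c Q) (c R))) (≋-trans R+Q≋a (≋-trans (≋-sym eq)
            (≋-reflexive (trans (ℕₚ.*-identityˡ _) (sym (ℕₚ.+-identityʳ _)))))))))
        cases false false _ _ eq = ⊥-elim (a≢0 (≋-sym eq))

      tangent : c R ≋ a
      tangent = let α , β , αβ≢0 , nonzero = jamison forms forms-bound forms-origin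
                    open Tilt α β αβ≢0 nonzero
                in cases (S′ (X R)) (S′ (X Q)) refl refl sum≋a

    ρ : ∃ λ ρ → suc (suc ρ) ≡ q
    ρ = q ∸ 2 , ℕₚ.m+[n∸m]≡n 2≤q

    -- `R` and `Q` account for the 2: they are the points of the support inside `S`, and exactly
    -- this saving is required by `plane-bound`.
    2+outside : 2 + outside X B S < 2 * q ^ k
    2+outside = subst (_< 2 * q ^ k) (trans (inside+outside S) (cong (_+ outside X B S) two)) small

    extra : ∃ λ w → S w ≡ false × gain X B S w < suc (proj₁ ρ) + suc (proj₁ ρ)
    extra = small-gain X B {s = k} (suc (proj₁ ρ) + suc (proj₁ ρ)) subS sizeS
      (trans (solveℕ 2 (λ r k → conℕ 2 ⊹ r ⊹ k ⊜ r ⊹ (conℕ 2 ⊹ k)) refl r k) (sym n≡))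
      (plane-bound (proj₁ ρ) (proj₂ ρ) 2+outside)

    conclusion : c R ≋ a
    conclusion = let w , w∉S , gain< = extra in Plane.tangent w∉S (proj₂ ρ) gain<

  module OnSupport {R : Point F n} (BR : B R ≡ true) where

    -- Enlarging T one vector at a time avoids the support because there are more than |B| choices.
    avoiding : ∀ t s → t + s ≡ r → Σ Space λ T → Sub T × size T ≡ q ^ t × T (X R) ≡ false ×
      (∀ P → B P ≡ true → adj T (X R) (X P) ≡ true → P ≡ R)
    avoiding zero s t+s = zeroSpace , zeroSpace-sub , size-zeroSpace {suc n} , X-nonzero R , λ P BP → X-collinear
    avoiding (suc t) s t+s with avoiding t (suc s) (trans (ℕₚ.+-suc t s) t+s)
    ... | T , subT , sT , R∉T , only
      -- The averaging is done for the span of `T` and `R`, of codimension at least k + 2, although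
      -- the vector found is added to `T`: `R` has to stay outside.
      with small-gain X B {adj T (X R)} {suc t} {s + suc (suc k)} 1 (adj-sub subT) (size-adj-power t subT R∉T sT)
        (trans (sym (ℕₚ.+-assoc (suc t) s (suc (suc k)))) (trans (cong (_+ suc (suc k)) t+s) (sym n≡)))
        (ℕₚ.<-≤-trans (extension-bound 2≤q (outside<2q^k (adj T (X R))))
          (ℕₚ.+-monoˡ-≤ _ (ℕₚ.*-monoʳ-≤ 1 (ℕₚ.^-monoʳ-≤ q (ℕₚ.m≤n+m (suc (suc k)) s)))))
    ... | v , v∉ , gain<1 = adj T v , adj-sub subT , size-adj-power t subT v∉T sT
      , ≢true⇒≡false (λ R∈ → ≡true≢false (adj-exchange subT R∉T R∈) v∉)
      , only′
      where
      v∉T : T v ≡ false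
      v∉T = ≢true⇒≡false λ Tv → ≡true≢false (adj-base Tv) v∉
      only′ : ∀ P → B P ≡ true → adj (adj T v) (X R) (X P) ≡ true → P ≡ R
      only′ P BP P∈ with adj T (X R) (X P) in P∈TR
      ... | true = only P BP P∈TR
      ... | false = ⊥-elim (≡true≢false
        (∧-intro BP (∧-intro (adj-comm P∈) (not-intro P∈TR)))
        (count-none⁻ (ℕₚ.n<1⇒n≡0 gain<1) P))

    constant-on-support : c R ≋ a
    constant-on-support with avoiding r 0 (ℕₚ.+-identityʳ r)
    ... | T₁ , sub₁ , s₁ , R∉ , only
      -- The span of `T₁` and `R` has codimension k + 1, where averaging no longer excludes a second
      -- point `Q`.
      with small-gain X B {s = suc k} 2 (adj-sub sub₁) (size-adj-power r sub₁ R∉ s₁)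
        (trans (sym (ℕₚ.+-suc r (suc k))) (sym n≡)) (secant-bound 3≤q (outside<2q^k (adj T₁ (X R))))
    ... | v , v∉ , gain<2 with count<2 (λ P → B P ∧ (adj (adj T₁ (X R)) v (X P) ∧ not (adj T₁ (X R) (X P)))) gain<2
    ... | inj₁ none = ≋-trans (≋-sym (inner-one (adj (adj T₁ (X R)) v) (adj-base (adj-self sub₁)) only′))
        (constant (adj-sub (adj-sub sub₁)) (size-adj-power (suc r) (adj-sub sub₁) v∉ (size-adj-power r sub₁ R∉ s₁)) n<k+r+2)
      where
      only′ : ∀ P → B P ≡ true → adj (adj T₁ (X R)) v (X P) ≡ true → P ≡ R
      only′ P BP P∈ with adj T₁ (X R) (X P) in P∈T
      ... | true = only P BP P∈T
      ... | false = ⊥-elim (≡true≢false (∧-intro BP (∧-intro P∈ (not-intro P∈T))) (none P))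
    ... | inj₂ (Q , foundQ , unique) with ∧-elim {B Q} foundQ
    ...   | BQ , foundQ′ with ∧-elim {adj (adj T₁ (X R)) v (X Q)} foundQ′
    ...     | Q∈ , ¬Q∈T = Secant.conclusion BR BQ sub₁ s₁ R∉ (not-elim ¬Q∈T) only′
      where
      only′ : ∀ P → B P ≡ true → adj (adj T₁ (X R)) (X Q) (X P) ≡ true → P ≡ R ⊎ P ≡ Q
      -- Since `Q` lies in the span with v, replacing v by `Q` adds no further point of the support.
      only′ P BP P∈ with adj T₁ (X R) (X P) in P∈T
      ... | true = inj₁ (only P BP P∈T)
      ... | false = inj₂ (unique P (∧-intro BP (∧-intro
        (adj-least (adj-sub (adj-sub sub₁)) (λ _ → adj-base) Q∈ (X P) P∈) (not-intro P∈T))))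

  -- From values of the codeword to numbers of support points

  inside-weighted : ∀ (T : Space) → ∑ (λ P → ind (T (X P)) * c P) ≋ a * inside T
  inside-weighted T = ≋-trans (≋-∑ pointwise)
    (≋-reflexive (sym (NSum.*-distribˡ-sum a (λ P → ind (T (X P) ∧ B P)))))
    where
    pointwise : ∀ P → ind (T (X P)) * c P ≋ a * ind (T (X P) ∧ B P)
    pointwise P with T (X P) | B P in BP
    ... | false | _     = ≋-reflexive (sym (ℕₚ.*-zeroʳ a))
    ... | true  | true  = ≋-trans (≋-reflexive (ℕₚ.*-identityˡ _))
      (≋-trans (OnSupport.constant-on-support BP) (≋-reflexive (sym (ℕₚ.*-identityʳ a))))
    ... | true  | false = ≋-trans (≋-reflexive (ℕₚ.*-identityˡ _))
      (≋-trans (B-false BP) (≋-reflexive (sym (ℕₚ.*-zeroʳ a))))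

  module _ (isPrime : Prime p) (2<p : 2 < p) where

    -- As c ≡ a on the support, the constant value a is also a times the number of support points in
    -- `T`, and a can be cancelled.
    inside-large : ∀ {T t s} → t + s ≡ suc n → s ≤ k → Sub T → size T ≡ q ^ t → inside T ≋ 1
    inside-large {T} {t} {s} t+s s≤k subT sT = ≋-*-cancelˡ isPrime a≢0
      (≋-trans (≋-sym (inside-weighted T)) (≋-trans (constant subT sT n<k+t) (≋-reflexive (sym (ℕₚ.*-identityʳ a)))))
      where
      n<k+t : n < k + t
      n<k+t = subst (_≤ k + t) t+s (subst (t + s ≤_) (ℕₚ.+-comm t k) (ℕₚ.+-monoʳ-≤ t s≤k))

    few-new : ∀ {T t s} → t + s ≡ suc n → k < s → Sub T → size T ≡ q ^ t →
      ∃ λ v → T v ≡ false × gain X B T v < 2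
    few-new {T} {t} {s} t+s k<s subT sT = small-gain X B {s = s} 2 subT sT t+s
      (ℕₚ.<-≤-trans (secant-bound 3≤q (outside<2q^k T))
        (ℕₚ.+-monoˡ-≤ _ (ℕₚ.*-monoʳ-≤ 2 (ℕₚ.^-monoʳ-≤ q k<s))))

    no-new : ∀ {T t s} → t + s ≡ suc n → suc k < s → Sub T → size T ≡ q ^ t →
      ∃ λ v → T v ≡ false × gain X B T v < 1
    no-new {T} {t} {s} t+s k<s subT sT = small-gain X B {s = s} 1 subT sT t+s
      (ℕₚ.<-≤-trans (extension-bound 2≤q (outside<2q^k T))
        (ℕₚ.+-monoˡ-≤ _ (ℕₚ.*-monoʳ-≤ 1 (ℕₚ.^-monoʳ-≤ q k<s))))

    inside-gain : ∀ T v g → gain X B T v ≡ g → inside (adj T v) ≡ inside T + g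
    inside-gain T v g eq = trans (inside-adj T v) (cong (inside T +_) eq)

    below-2 : ∀ {g} → g < 2 → g ≡ 0 ⊎ g ≡ 1
    below-2 {zero} _ = inj₁ refl
    below-2 {suc zero} _ = inj₂ refl
    below-2 {suc (suc _)} (s≤s (s≤s ()))

    -- Induction on the codimension s. At s = k + 1 an extension with at most one new point turns 1
    -- into 1 or 0; for larger s an extension with no new point passes the alternative on unchanged.
    zero-or-one : ∀ s {t T} → t + s ≡ suc n → Sub T → size T ≡ q ^ t → inside T ≋ 0 ⊎ inside T ≋ 1
    zero-or-one s {t} {T} t+s subT sT with s ℕ.≤? k
    ... | yes s≤k = inj₂ (inside-large t+s s≤k subT sT)
    zero-or-one zero t+s subT sT | no s≰k = ⊥-elim (s≰k z≤n)
    zero-or-one (suc s) {t} {T} t+s subT sT | no s≰k with s ℕ.≤? k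
    ... | yes s≤k = one-step (few-new t+s (ℕₚ.≰⇒> s≰k) subT sT)
      where
      one-step : (∃ λ v → T v ≡ false × gain X B T v < 2) → inside T ≋ 0 ⊎ inside T ≋ 1
      one-step (v , v∉ , gain<2) = by-gain (below-2 gain<2)
        where
        large : inside (adj T v) ≋ 1
        large = inside-large (trans (sym (ℕₚ.+-suc t s)) t+s) s≤k (adj-sub subT) (size-adj-power t subT v∉ sT)
        by-gain : gain X B T v ≡ 0 ⊎ gain X B T v ≡ 1 → inside T ≋ 0 ⊎ inside T ≋ 1
        by-gain (inj₁ g≡0) = inj₂ (≋-trans
          (≋-reflexive (sym (trans (inside-gain T v 0 g≡0) (ℕₚ.+-identityʳ _)))) large)
        by-gain (inj₂ g≡1) = inj₁ (≋-+-cancelˡ 1 (≋-trans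
          (≋-reflexive (sym (trans (inside-gain T v 1 g≡1) (ℕₚ.+-comm _ 1)))) large))
    ... | no s≰k′ = one-step (no-new t+s (s≤s (ℕₚ.≰⇒> s≰k′)) subT sT)
      where
      one-step : (∃ λ v → T v ≡ false × gain X B T v < 1) → inside T ≋ 0 ⊎ inside T ≋ 1
      one-step (v , v∉ , gain<1) = subst (λ x → x ≋ 0 ⊎ x ≋ 1)
        (trans (inside-gain T v 0 (ℕₚ.n<1⇒n≡0 gain<1)) (ℕₚ.+-identityʳ _))
        (zero-or-one s (trans (sym (ℕₚ.+-suc t s)) t+s) (adj-sub subT) (size-adj-power t subT v∉ sT))

    1<p : 1 < p
    1<p = ℕₚ.<-trans (s≤s (s≤s z≤n)) 2<p

    two≢0 : ¬ (2 ≋ 0)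
    two≢0 2≋0 = ℕₚ.<⇒≱ 2<p (ℕ∣.∣⇒≤ (≋0⇒∣ 2≋0))

    two≢1 : ¬ (2 ≋ 1)
    two≢1 2≋1 = ℕₚ.<⇒≱ 1<p (ℕ∣.∣⇒≤ (≋0⇒∣ (≋-+-cancelˡ 1 2≋1)))

    -- The line `ℓ` joining `P` and `R` meets `T` in `P` alone, as a second point would bring `R`
    -- into `T`; off `T` it has no support point but `R`. Hence `ℓ` carries exactly two.
    no-2-secant : ∀ {T P R} → Sub T → T (X P) ≡ true → B P ≡ true → T (X R) ≡ false → B R ≡ true →
      (∀ Q → B Q ≡ true → adj T (X R) (X Q) ≡ true → T (X Q) ≡ false → Q ≡ R) → 2 ≤ suc n → ⊥
    no-2-secant {T} {P} {R} subT P∈T BP R∉T BR unique 2≤n+1 = refute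
      (zero-or-one (suc n ∸ 2) {2} {ℓ} (ℕₚ.m+[n∸m]≡n 2≤n+1) (adj-sub (adj-sub zeroSpace-sub))
        (size-adj-power 1 (adj-sub zeroSpace-sub) R∉P (size-adj-power 0 zeroSpace-sub (X-nonzero P) (size-zeroSpace {suc n}))))
      where
      ℓ : Space
      ℓ = adj (adj zeroSpace (X P)) (X R)
      P⊆T : ∀ x → adj zeroSpace (X P) x ≡ true → T x ≡ true
      P⊆T = adj-least subT (zeroSpace-least subT) P∈T
      R∉P : adj zeroSpace (X P) (X R) ≡ false
      R∉P = ≢true⇒≡false λ R∈ → ≡true≢false (P⊆T (X R) R∈) R∉T
      one : inside (adj zeroSpace (X P)) ≡ 1
      one = count-one P (∧-intro (adj-self zeroSpace-sub) BP)
        λ Q found → X-collinear (proj₁ (∧-elim {adj zeroSpace (X P) (X Q)} found))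
      R-new : gain X B (adj zeroSpace (X P)) (X R) ≡ 1
      R-new = count-one R (∧-intro BR (∧-intro (adj-self (adj-sub zeroSpace-sub)) (not-intro R∉P))) only-R
        where
        only-R : ∀ Q → B Q ∧ (ℓ (X Q) ∧ not (adj zeroSpace (X P) (X Q))) ≡ true → Q ≡ R
        only-R Q found with ∧-elim {B Q} found
        ... | BQ , found′ with ∧-elim {ℓ (X Q)} found′
        ...   | Q∈ℓ , Q∉P with T (X Q) in TQ
        ...     | false = unique Q BQ (adj-least (adj-sub subT) (λ x x∈ → adj-base (P⊆T x x∈)) (adj-self subT) (X Q) Q∈ℓ) TQ
        ...     | true = ⊥-elim (≡true≢false
          (adj-least subT P⊆T TQ (X R) (adj-exchange (adj-sub zeroSpace-sub) (not-elim Q∉P) Q∈ℓ)) R∉T)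
      two : inside ℓ ≡ 2
      two = trans (inside-adj _ _) (cong₂ _+_ one R-new)
      refute : inside ℓ ≋ 0 ⊎ inside ℓ ≋ 1 → ⊥
      refute (inj₁ eq) = two≢0 (subst (_≋ 0) two eq)
      refute (inj₂ eq) = two≢1 (subst (_≋ 1) two eq)

    -- Again induction on the codimension. A single new point is excluded by `no-2-secant`, so above
    -- codimension k the extension has the same number of support points, and in particular is still
    -- met.
    meets-in-one : 2 ≤ suc n → ∀ s {t T} → t + s ≡ suc n → Sub T → size T ≡ q ^ t → 1 ≤ inside T → inside T ≋ 1
    meets-in-one 2≤n+1 s {t} {T} t+s subT sT meets with s ℕ.≤? k
    ... | yes s≤k = inside-large t+s s≤k subT sT
    meets-in-one 2≤n+1 zero t+s subT sT meets | no s≰k = ⊥-elim (s≰k z≤n)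
    meets-in-one 2≤n+1 (suc s) {t} {T} t+s subT sT meets | no s≰k =
      one-step (few-new t+s (ℕₚ.≰⇒> s≰k) subT sT)
      where
      one-step : (∃ λ v → T v ≡ false × gain X B T v < 2) → inside T ≋ 1
      one-step (v , v∉ , gain<2) = by-count (count<2 _ gain<2)
        where
        by-count : _ → inside T ≋ 1
        by-count (inj₁ none) = subst (_≋ 1) inside≡
          (meets-in-one 2≤n+1 s (trans (sym (ℕₚ.+-suc t s)) t+s) (adj-sub subT) (size-adj-power t subT v∉ sT)
            (subst (1 ≤_) (sym inside≡) meets))
          where
          inside≡ : inside (adj T v) ≡ inside T
          inside≡ = trans (inside-gain T v 0 (count-none none)) (ℕₚ.+-identityʳ _)
        by-count (inj₂ (R , found , unique)) =
          let P , foundP = count-positive meets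
              P∈T , BP = ∧-elim {T (X P)} foundP
              BR , found′ = ∧-elim {B R} found
              R∈ , ¬R∈T = ∧-elim {adj T v (X R)} found′
          in ⊥-elim (no-2-secant subT P∈T BP (not-elim ¬R∈T) BR
            (λ Q BQ Q∈ Q∉T → unique Q (∧-intro BQ (∧-intro
              (adj-least (adj-sub subT) (λ _ → adj-base) R∈ (X Q) Q∈) (not-intro Q∉T)))) 2≤n+1)

-- Codewords are constant on large subspaces

module _ {q : ℕ} (F : FiniteField q) (p n k : ℕ) (p∣q : p ∣ q) where

  open Subspaces F
  open Points F
  open PointSet n
  open Congruence p

  combination : List (ℕ × (Vect F (suc n) → Bool)) → Point F n → ℕ
  combination gens P = sum (List.map (λ g → proj₁ g * incVec F p {n} (proj₂ g) P) gens)

  -- By dimension each generator meets `T` in a nonzero subspace, hence in 1 mod p points, and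
  -- contributes just its coefficient. The constant a is thus the sum of the coefficients, whatever
  -- `T` is.
  inner-combination : ∀ {T t} gens → All (λ g → ProjSubspace F n k (proj₂ g)) gens →
    Sub T → size T ≡ q ^ t → n < k + t →
    ∑ (λ P → ind (T (X P)) * combination gens P) ≋ sum (List.map proj₁ gens)
  inner-combination {T} [] [] subT sT n<k+t = ≋-reflexive (∑-zero λ P → ℕₚ.*-zeroʳ (ind (T (X P))))
  inner-combination {T} {t} ((x , G) ∷ gens) ((subG , dimG) ∷ spaces) subT sT n<k+t = ≋-trans
    (≋-reflexive (trans (∑-cong expand) (trans (NSum.∑-distrib-+ _ (λ P → ind (T (X P)) * combination gens P))
      (cong (_+ _) (sym (NSum.*-distribˡ-sum x (λ P → ind (T (X P) ∧ G (X P)))))))))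
    (≋-+ (≋-trans (≋-*ˡ x meets) (≋-reflexive (ℕₚ.*-identityʳ x)))
      (inner-combination gens spaces subT sT n<k+t))
    where
    expand : ∀ P → ind (T (X P)) * combination ((x , G) ∷ gens) P ≡
      x * ind (T (X P) ∧ G (X P)) + ind (T (X P)) * combination gens P
    expand P = trans (solveℕ 4 (λ i x g s → i ⊛ (x ⊛ g ⊹ s) ⊜ x ⊛ (i ⊛ g) ⊹ i ⊛ s) refl
        (ind (T (X P))) x (ind (G (X P))) (combination gens P))
      (cong (λ y → x * y + _) (sym (ind-∧ (T (X P)) (G (X P)))))
    intersection-sub : Sub (λ v → T v ∧ G v)
    intersection-sub = ∧-intro (proj₁ subT) (proj₁ subG)
      , (λ u v u∈ v∈ → let Tu , Gu = ∧-elim {T u} u∈ ; Tv , Gv = ∧-elim {T v} v∈ in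
          ∧-intro (proj₁ (proj₂ subT) u v Tu Tv) (proj₁ (proj₂ subG) u v Gu Gv))
      , λ b v v∈ → let Tv , Gv = ∧-elim {T v} v∈ in
          ∧-intro (proj₂ (proj₂ subT) b v Tv) (proj₂ (proj₂ subG) b v Gv)
    meets : count (λ P → T (X P) ∧ G (X P)) ≋ 1
    meets = let v , Tv , Gv , v≢0 = intersection subT subG sT (size-HasDim dimG)
                  (subst (suc n <_) (ℕₚ.+-comm (suc k) t) (s≤s n<k+t))
            in count≋1 p∣q intersection-sub (∧-intro Tv Gv) v≢0

countPts≡count : ∀ {q} (F : FiniteField q) {n} (f : Point F n → Bool) → countPts F {n} f ≡ count f
countPts≡count F f = length-filterᵇ f (λ P → P)

sumPts≡∑ : ∀ {q} (F : FiniteField q) {n} (f : Point F n → ℕ) → sumPts F {n} f ≡ ∑ f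
sumPts≡∑ F f = sum-map-tabulate f (λ P → P)

theorem3p4 : (p h q n k : ℕ) → Prime p → 3 < p → 1 ≤ h → q ≡ p ^ h →
    2 ≤ n → 1 ≤ k → k ≤ n ∸ 1 →
    (F : FiniteField q) →
    (c : Codeword F p n) → InCode F p n k c →
    weight F p c < 2 * q ^ k →
    Σ (Vect F (suc n) → Bool) (λ S → ProjSubspace F n (n ∸ k) S × ¬ (innerS F p c S ≡ 0 [mod p ])) →
    (U : Vect F (suc n) → Bool) → IsSubspace F U →
    1 ≤ meetSupp F p c U → meetSupp F p c U ≡ 1 [mod p ]
theorem3p4 p (suc h) q (suc n) k isPrime 3<p (s≤s _) q≡p^h 2≤n 1≤k k≤n F c (gens , spaces , c≋) small
  (S , (subS , dimS) , inner≢0) U subU meets =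
  -- `U` is given without a dimension; its cardinality supplies one.
  let t , sU = size-power subU in
  subst (_≋ 1) (sym (countPts≡count F {N} (λ P → U (pt F P) ∧ inSupp F p {N} c P)))
    (Constant.meets-in-one isPrime (ℕₚ.<-trans (s≤s (s≤s (s≤s z≤n))) 3<p) (ℕₚ.m≤n⇒m≤1+n 2≤n)
      (suc (suc n) ∸ t) {t} (ℕₚ.m+[n∸m]≡n (t≤n+2 {t} sU)) subU sU
      (subst (1 ≤_) (countPts≡count F {N} (λ P → U (pt F P) ∧ inSupp F p {N} c P)) meets))
  where
  open Congruence p
  open Subspaces F
  N = suc n
  a = sum (List.map proj₁ gens)

  p∣q : p ∣ q
  p∣q = subst (p ∣_) (sym q≡p^h) (ℕ∣.m∣m*n (p ^ h))

  3≤q : 3 ≤ q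
  3≤q = ℕₚ.≤-trans (ℕₚ.<⇒≤ 3<p) (ℕ∣.∣⇒≤ p∣q)

  constant : ∀ {T t} → Sub T → size T ≡ q ^ t → N < k + t → ∑ (λ P → ind (T (pt F {N} P)) * c P) ≋ a
  constant {T} subT sT lt = ≋-trans (≋-∑ λ P → ≋-*ˡ (ind (T (pt F P))) (c≋ P))
    (inner-combination F p N k p∣q gens spaces subT sT lt)

  ind-if : ∀ b x → (if b then x else 0) ≡ ind b * x
  ind-if true  x = sym (ℕₚ.*-identityˡ x)
  ind-if false x = refl

  N<k+dimS : N < k + suc (N ∸ k)
  N<k+dimS = ℕₚ.≤-reflexive (trans (cong suc (sym (ℕₚ.m+[n∸m]≡n (ℕₚ.m≤n⇒m≤1+n k≤n)))) (sym (ℕₚ.+-suc k (N ∸ k))))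

  -- The given `S` has vector dimension N - k + 1, the least to which `constant` applies, so its
  -- nonzero inner product is a.
  a≢0 : ¬ (a ≋ 0)
  a≢0 a≋0 = inner≢0 (≋-trans
    (≋-reflexive (trans (sumPts≡∑ F {N} (λ P → if S (pt F P) then c P else 0)) (∑-cong λ P → ind-if (S (pt F {N} P)) (c P))))
    (≋-trans (constant subS (size-HasDim dimS) N<k+dimS) a≋0))

  -- The projective dimension is `N`, one more than the matched `n`, so `n ∸ k` is N - k - 1.
  module Constant = ConstantCodeword F p N k (n ∸ k) 3≤q
    (trans (cong (λ x → suc (suc x)) (sym (ℕₚ.m∸n+n≡m k≤n)))
      (solveℕ 2 (λ x k → conℕ 2 ⊹ (x ⊹ k) ⊜ x ⊹ (conℕ 2 ⊹ k)) refl (n ∸ k) k))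
    c a constant a≢0 (subst (_< 2 * q ^ k) (countPts≡count F {N} (inSupp F p {N} c)) small)

  t≤n+2 : ∀ {t} → size U ≡ q ^ t → t ≤ suc N
  t≤n+2 {t} sU with t ℕ.≤? suc N
  ... | yes t≤ = t≤
  ... | no t≰ = ⊥-elim (ℕₚ.<⇒≱ (ℕₚ.^-monoʳ-< q 2≤q (ℕₚ.≰⇒> t≰)) (subst (_≤ q ^ suc N) sU (size≤ U)))
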